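{- Let $P$ be a ranked poset that is a nice section. Then $P$ is very nice if and only if its rank $r(P)$ is not a positive multiple of $3$.
   Context: All posets are finite. For a poset $P$ and $p\in P$, the rank $r(p)$ of $p$ is the largest $m$ such that there is a chain $p_0<\dots<p_m=p$ in $P$. $P$ is ranked of rank $r(P)$ if every maximal chain has exactly $r(P)+1$ elements. A subset $Q\subseteq P$ (induced order) is a retract of $P$ if there is an order-preserving $f:P\to Q$ with $f(q)=q$ for all $q\in Q$; it is proper if $Q\neq P$. The ordinal sum of posets $P_1,\dots,P_k$ ($k\ge1$) is their disjoint union ordered by the orders of the $P_i$ together with $p<q$ whenever $p\in P_i,q\in P_j,i<j$. A section is either a two-element antichain or a poset on the set $\{[i,k]: 0\le i\le 2,\ 0\le k\le n\}$ (with $3(n+1)$ distinct elements), for some $n\ge 1$, such that: (1) $[i,k]<[i,l]$ whenever $0\le i\le 2$ and $0\le k<l\le n$; (2) for each $k$, $\{[0,k],[1,k],[2,k]\}$ is an antichain; (3) for all $i,j,k,l$, $[i,k]<[j,l]$ implies $[i+1,k]<[j+1,l]$ (first indices mod $3$); (4) for each $0\le k<n$ there are $i,j\in\{0,1,2\}$ with $[i,k]\not<[j,k+1]$. A section $P$ is nice if for all $p<q$ in $P$ there exist $r,s\in P$ with $p<r$, $q\not<r$, and $s<q$, $s\not<p$. A tower of sections is an ordinal sum of one or more sections. A section is very nice if no proper retract of it is isomorphic to a tower of sections.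
   Formalization: "Nice" is taken with q≰r and s≰p instead of q≮r and s≮p; with the latter every section is nice (r=q, s=p) and the claim fails for three disjoint two-element chains, a ranked section of rank 1 that retracts onto a two-element antichain. -}

module Defs where

open import Level using (0ℓ)
open import Data.Fin as Fin using (Fin; zero; suc; inject₁)
import Data.Fin.Properties as Fin
open import Data.List using (List; length)
open import Data.List.Relation.Binary.Subset.Propositional using (_⊆_)
open import Data.List.Relation.Unary.Linked using (Linked)
open import Data.Nat using (ℕ; suc; _≥_)
open import Data.Product using (Σ; _×_; _,_; proj₁; ∃; ∃-syntax)
open import Data.Sum using (_⊎_)
open import Function using (_↔_; Inverse)
open import Relation.Binary using (Rel; Poset; IsDecPartialOrder; _Preserves_⟶_)
import Relation.Binary.Construct.NonStrictToStrict as ToStrict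
import Relation.Binary.Construct.On as On
open import Relation.Binary.Morphism.Structures using (IsOrderIsomorphism)
open import Relation.Binary.PropositionalEquality
  using (_≡_; refl; cong; isEquivalence)
open import Relation.Nullary using (¬_; contradiction)
open import Relation.Unary using (Pred; _∈_; Universal)

record FinPoset : Set₁ where
  field
    Carrier           : Set
    _≤_               : Rel Carrier 0ℓ
    isDecPartialOrder : IsDecPartialOrder _≡_ _≤_
    size              : ℕ
    enumeration       : Fin size ↔ Carrier

  open IsDecPartialOrder isDecPartialOrder public
    using (isPartialOrder; _≟_; _≤?_)
    renaming (refl to ≤-refl; trans to ≤-trans; antisym to ≤-antisym)

  poset : Poset 0ℓ 0ℓ 0ℓ
  poset = record { isPartialOrder = isPartialOrder }

  open ToStrict _≡_ _≤_ public using (_<_)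

_≅_ : Poset 0ℓ 0ℓ 0ℓ → Poset 0ℓ 0ℓ 0ℓ → Set
P ≅ Q = ∃ (IsOrderIsomorphism P._≈_ Q._≈_ P._≤_ Q._≤_)
  where
  module P = Poset P
  module Q = Poset Q

module _ (P : FinPoset) where
  open FinPoset P

  -- A chain is given by the list of its elements in increasing order, so
  -- its number of elements is the length of the list.
  IsChain : List Carrier → Set
  IsChain = Linked _<_

  IsMaximalChain : List Carrier → Set
  IsMaximalChain c = IsChain c × (∀ d → IsChain d → c ⊆ d → d ⊆ c)

  IsRankedOfRank : ℕ → Set
  IsRankedOfRank r = ∀ c → IsMaximalChain c → length c ≡ suc r

  -- Elements of the subset are compared through their first components
  -- only, also for equality, so membership proofs do not matter.
  induced : Pred Carrier 0ℓ → Poset 0ℓ 0ℓ 0ℓ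
  induced Q = On.poset poset (proj₁ {B = _∈ Q})

  -- The retraction P → Q is given as a self-map of P with values in Q.
  IsRetract : Pred Carrier 0ℓ → Set
  IsRetract Q = ∃[ f ] (f Preserves _≤_ ⟶ _≤_)
                     × (∀ p → f p ∈ Q)
                     × (∀ q → q ∈ Q → f q ≡ q)

  IsProper : Pred Carrier 0ℓ → Set
  IsProper Q = ¬ Universal Q

module _ {k : ℕ} (P : Fin k → FinPoset) where
  open FinPoset

  data OrdinalSum≤ : Rel (Σ (Fin k) λ i → Carrier (P i)) 0ℓ where
    across : ∀ {i j p q} → i Fin.< j → OrdinalSum≤ (i , p) (j , q)
    within : ∀ {i p q} → _≤_ (P i) p q → OrdinalSum≤ (i , p) (i , q)

  private
    reflexive : ∀ {x y} → x ≡ y → OrdinalSum≤ x y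
    reflexive {i , _} refl = within (≤-refl (P i))

    transitive : ∀ {x y z} → OrdinalSum≤ x y → OrdinalSum≤ y z → OrdinalSum≤ x z
    transitive (across i<j) (across j<l) = across (Fin.<-trans i<j j<l)
    transitive (across i<j) (within _)   = across i<j
    transitive (within _)   (across i<j) = across i<j
    transitive (within {i} p≤q) (within q≤s) = within (≤-trans (P i) p≤q q≤s)

    antisymmetric : ∀ {x y} → OrdinalSum≤ x y → OrdinalSum≤ y x → x ≡ y
    antisymmetric (across i<j) (across j<i) = contradiction j<i (Fin.<-asym i<j)
    antisymmetric (across i<i) (within _)   = contradiction i<i (Fin.<-irrefl refl)
    antisymmetric (within _)   (across i<i) = contradiction i<i (Fin.<-irrefl refl)
    antisymmetric (within {i} p≤q) (within q≤p) =
      cong (i ,_) (≤-antisym (P i) p≤q q≤p)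

  ordinalSum : Poset 0ℓ 0ℓ 0ℓ
  ordinalSum = record
    { _≤_            = OrdinalSum≤
    ; isPartialOrder = record
      { isPreorder = record
        { isEquivalence = isEquivalence
        ; reflexive     = reflexive
        ; trans         = transitive
        }
      ; antisym = antisymmetric
      }
    }

next : Fin 3 → Fin 3
next zero             = suc zero
next (suc zero)       = suc (suc zero)
next (suc (suc zero)) = zero

module _ (P : FinPoset) where
  open FinPoset P

  IsTwoAntichain : Set
  IsTwoAntichain = (Fin 2 ↔ Carrier) × (∀ p q → ¬ p < q)

  -- The bijection label names the elements [ i , k ] of P.
  record IsCyclicLabelling (n : ℕ) (label : (Fin 3 × Fin (suc n)) ↔ Carrier) : Set where
    [_,_] : Fin 3 → Fin (suc n) → Carrier
    [ i , k ] = Inverse.to label (i , k)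

    field
      increasing : ∀ i k l → k Fin.< l → [ i , k ] < [ i , l ]
      antichain  : ∀ k i j → ¬ [ i , k ] < [ j , k ]
      cyclic     : ∀ i j k l → [ i , k ] < [ j , l ] → [ next i , k ] < [ next j , l ]
      incomplete : ∀ (k : Fin n) → ∃[ i ] ∃[ j ] ¬ [ i , inject₁ k ] < [ j , suc k ]

  IsSection : Set
  IsSection = IsTwoAntichain ⊎ (∃[ n ] n ≥ 1 × ∃ (IsCyclicLabelling n))

  -- The conditions on r and s use ≰. With ≮ in place of ≰, the choice
  -- r = q, s = p would make every poset nice.
  IsNice : Set
  IsNice = ∀ p q → p < q →
           (∃[ r ] p < r × ¬ q ≤ r) × (∃[ s ] s < q × ¬ s ≤ p)

IsIsomorphicToTower : Poset 0ℓ 0ℓ 0ℓ → Set₁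
IsIsomorphicToTower T =
  ∃[ k ] Σ (Fin (suc k) → FinPoset) λ S →
  (∀ i → IsSection (S i)) × T ≅ ordinalSum S

IsVeryNice : FinPoset → Set₁
IsVeryNice P = ∀ (Q : Pred (FinPoset.Carrier P) 0ℓ) →
               IsRetract P Q → IsProper P Q → ¬ IsIsomorphicToTower (induced P Q)

{-# OPTIONS --safe #-}

-- In a ranked nice section of rank n ≥ 1 every covering pair lies in adjacent
-- rows, and each element misses exactly one element of the next row. Rotating
-- the rows makes the missed element the one with the same first index, so the
-- section is the crown order ⊑, cut at level n. A retract of it that is a
-- tower is recorded by monotone maps e (from the tower) and g (to the tower)
-- with g ∘ e = id.
--
-- If 3 ∣ n, the pairs {(0,0),(1,0)}, {(2,1),(2,2)}, {(0,3),(1,3)}, … form a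
-- retract. Conversely, suppose the retract is proper. A section with full rows
-- would have to start at level 0 and end at level n, so all its sections are
-- two-element antichains. Follow them upwards together with g: after a
-- horizontal pair at level k the next pair is vertical, at levels k + 1 and
-- k + 2, and then a horizontal one at level k + 3, unless the images of the
-- remaining points force an endless continuation. Only a horizontal pair at
-- level n can be the last one, whence 3 ∣ n.

module Submission where

open import Defs
open import Data.Nat using (ℕ; _>_)
open import Data.Nat.Divisibility using (_∣_)
open import Data.Product using (_×_)
open import Function using (_⇔_)
open import Relation.Nullary using (¬_)

open import Level using (0ℓ)
open import Data.Empty using (⊥)
open import Data.Fin as Fin using (Fin; zero; suc; toℕ; fromℕ; fromℕ<; inject₁)
open import Data.Fin.Patterns using (0F; 1F; 2F)
import Data.Fin.Properties as Fin
open import Data.Fin.Relation.Unary.Top using (view; ‵fromℕ; ‵inject₁)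
open import Data.List using (List; []; _∷_; map; filter; length; allFin)
open import Data.List.Membership.Propositional using (_∈_; lose)
open import Data.List.Membership.Propositional.Properties
  using (∈-map⁺; ∈-filter⁺; ∈-allFin)
open import Data.List.Properties using (length-map; length-tabulate; filter-all; filter-notAll)
open import Data.List.Relation.Binary.Subset.Propositional using (_⊆_)
open import Data.List.Relation.Unary.All as All using (All; []; _∷_)
open import Data.List.Relation.Unary.All.Properties using (all-filter)
open import Data.List.Relation.Unary.AllPairs using (AllPairs; []; _∷_)
import Data.List.Relation.Unary.AllPairs.Properties as AllPairs
open import Data.List.Relation.Unary.Any using (here; there)
open import Data.List.Relation.Unary.Linked using ([-])
open import Data.List.Relation.Unary.Linked.Properties using (AllPairs⇒Linked; Linked⇒AllPairs)
open import Data.Nat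
open import Data.Nat.Divisibility using (divides; _∣0; ∣m∣n⇒∣m+n; ∣-refl)
open import Data.Nat.Properties
open import Data.Product using (Σ; _,_; proj₁; proj₂; ∃; ∃-syntax)
open import Data.Product.Properties using (≡-dec)
open import Data.Sum using (_⊎_; inj₁; inj₂)
open import Data.Unit using (⊤; tt)
open import Function using (Inverse; _∘_; mk⇔)
open import Function.Construct.Identity using (↔-id)
open import Function.Definitions using (Injective)
open import Relation.Binary using (Rel; Decidable; Transitive)
import Relation.Binary.Construct.NonStrictToStrict as ToStrict
open import Relation.Binary.Morphism.Structures using (IsOrderIsomorphism)
open import Relation.Binary.PropositionalEquality hiding ([_])
open import Relation.Binary.PropositionalEquality.Properties using (isPartialOrder)
open import Relation.Nullary using (Dec; contradiction; yes; no)
open import Relation.Nullary.Decidable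
  using (from-yes; ¬?; _×-dec_; _⊎-dec_; _→-dec_)
open import Relation.Unary as Unary using (Pred)

-- The crown order on three columns.

Point : Set
Point = Fin 3 × ℕ

column : Point → Fin 3
column = proj₁

level : Point → ℕ
level = proj₂

data _⊑_ : Rel Point 0ℓ where
  stay : ∀ {x} → x ⊑ x
  step : ∀ {a b k} → a ≢ b → (a , k) ⊑ (b , suc k)
  jump : ∀ {a b k l} → 2 + k ≤ l → (a , k) ⊑ (b , l)

⊑⇒level≤ : ∀ {x y} → x ⊑ y → level x ≤ level y
⊑⇒level≤ stay       = ≤-refl
⊑⇒level≤ (step _)   = n≤1+n _
⊑⇒level≤ (jump k<l) = ≤-trans (n≤1+n _) (<⇒≤ k<l)

⊑-sameLevel : ∀ {a b k} → (a , k) ⊑ (b , k) → a ≡ b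
⊑-sameLevel stay       = refl
⊑-sameLevel (jump k<k) = contradiction (<⇒≤ k<k) 1+n≰n

step⁻ : ∀ {a b k} → (a , k) ⊑ (b , suc k) → a ≢ b
step⁻ (step a≢b) = a≢b
step⁻ (jump k<k) = contradiction k<k 1+n≰n

beyond : ∀ {a k w} → ¬ (a , k) ⊑ w → k < level w → w ≡ (a , suc k)
beyond {a} {k} {b , l} a⋢w k<l with suc k ≟ l | a Fin.≟ b
... | yes refl | yes refl = refl
... | yes refl | no a≢b   = contradiction (step a≢b) a⋢w
... | no 1+k≢l | _        = contradiction (jump (≤∧≢⇒< k<l 1+k≢l)) a⋢w

_⊑?_ : Decidable _⊑_
(a , k) ⊑? (b , l) with k <? l
... | no k≮l with ≡-dec Fin._≟_ _≟_ (a , k) (b , l)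
...   | yes refl = yes stay
...   | no x≢y   = no λ where
  stay        → x≢y refl
  (step _)    → k≮l ≤-refl
  (jump k<l)  → k≮l (<⇒≤ k<l)
(a , k) ⊑? (b , l) | yes k<l with suc k ≟ l | a Fin.≟ b
... | yes refl | no a≢b   = yes (step a≢b)
... | yes refl | yes refl = no λ x⊑y → step⁻ x⊑y refl
... | no 1+k≢l | _        = yes (jump (≤∧≢⇒< k<l 1+k≢l))

Distinct : Fin 3 → Fin 3 → Fin 3 → Set
Distinct a b c = a ≢ b × a ≢ c × b ≢ c

abstract
  distinct-cover : ∀ a b c → Distinct a b c → ∀ x → x ≡ a ⊎ x ≡ b ⊎ x ≡ c
  distinct-cover = from-yes (Fin.all? {n = 3} λ a → Fin.all? {n = 3} λ b → Fin.all? {n = 3} λ c →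
    (¬? (a Fin.≟ b) ×-dec ¬? (a Fin.≟ c) ×-dec ¬? (b Fin.≟ c)) →-dec
    Fin.all? λ x → (x Fin.≟ a) ⊎-dec (x Fin.≟ b) ⊎-dec (x Fin.≟ c))

  third : ∀ (a b : Fin 3) → ∃[ c ] c ≢ a × c ≢ b
  third = from-yes (Fin.all? {n = 3} λ a → Fin.all? {n = 3} λ b → Fin.any? {n = 3} λ c →
    ¬? (c Fin.≟ a) ×-dec ¬? (c Fin.≟ b))

injective⇒surjective : (f : Fin 3 → Fin 3) → Injective _≡_ _≡_ f → ∀ a → ∃[ i ] f i ≡ a
injective⇒surjective f inj a with distinct-cover (f 0F) (f 1F) (f 2F)
  ((λ ()) ∘ inj {0F} {1F} , (λ ()) ∘ inj {0F} {2F} , (λ ()) ∘ inj {1F} {2F}) a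
... | inj₁ refl        = _ , refl
... | inj₂ (inj₁ refl) = _ , refl
... | inj₂ (inj₂ refl) = _ , refl

others : ∀ a → ∃[ b ] ∃[ c ] Distinct a b c
others a with third a a
... | b , b≢a , _ with third a b
...   | c , c≢a , c≢b = b , c , ≢-sym b≢a , ≢-sym c≢a , ≢-sym c≢b

rotate : ∀ {a b c} → Distinct a b c → Distinct c a b
rotate (a≢b , a≢c , b≢c) = ≢-sym a≢c , ≢-sym b≢c , a≢b

swap : ∀ {a b c} → Distinct a b c → Distinct a c b
swap (a≢b , a≢c , b≢c) = a≢c , a≢b , ≢-sym b≢c

-- On level k + 1 the point `(b , k)` misses column `b` and `(c , k)` misses column `c`, so only
-- column `a` is left there.
above-pair : ∀ {a b c k w} → Distinct a b c → (b , k) ⊑ w → (c , k) ⊑ w →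
             w ≡ (a , suc k) ⊎ 2 + k ≤ level w
above-pair (_ , _ , b≢c) stay c⊑b = contradiction (sym (⊑-sameLevel c⊑b)) b≢c
above-pair {w = x , _} d (step b≢x) c⊑w with distinct-cover _ _ _ d x
... | inj₁ refl        = inj₁ refl
... | inj₂ (inj₁ refl) = contradiction refl b≢x
... | inj₂ (inj₂ refl) = contradiction refl (step⁻ c⊑w)
above-pair _ (jump 2+k≤l) _ = inj₂ 2+k≤l

above-pair-avoiding : ∀ {a b c k w} → Distinct a b c → (b , k) ⊑ w → (c , k) ⊑ w →
                      ¬ (a , suc k) ⊑ w → w ≡ (a , 2 + k)
above-pair-avoiding d b⊑w c⊑w a⋢w with above-pair d b⊑w c⊑w
... | inj₁ refl  = contradiction stay a⋢w
... | inj₂ 2+k≤w = beyond a⋢w 2+k≤w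

-- On level k + 1 only `(a , suc k)` is above itself, and it is the point that `(a , k)` misses.
above-column : ∀ {a k w} → (a , k) ⊑ w → (a , suc k) ⊑ w → 2 + k ≤ level w
above-column a⊑w stay         = contradiction refl (step⁻ a⊑w)
above-column _   (step _)     = ≤-refl
above-column _   (jump 3+k≤l) = <⇒≤ 3+k≤l

notAbove : ∀ {a b c k w} → Distinct a b c → ¬ (a , k) ⊑ w → k ≤ level w →
           w ≡ (b , k) ⊎ w ≡ (c , k) ⊎ w ≡ (a , suc k)
notAbove {k = k} {w = x , l} d a⋢w k≤l with k ≟ l
... | no k≢l = inj₂ (inj₂ (beyond a⋢w (≤∧≢⇒< k≤l k≢l)))
... | yes refl with distinct-cover _ _ _ d x
...   | inj₁ refl        = contradiction stay a⋢w
...   | inj₂ (inj₁ refl) = inj₁ refl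
...   | inj₂ (inj₂ refl) = inj₂ (inj₁ refl)

⊑-offColumn : ∀ {x y} → column x ≢ column y → level x < level y → x ⊑ y
⊑-offColumn {_ , k} {_ , l} a≢b k<l with suc k ≟ l
... | yes refl = step a≢b
... | no 1+k≢l = jump (≤∧≢⇒< k<l 1+k≢l)

⊑∧level≡⇒≡ : ∀ {x y} → x ⊑ y → level x ≡ level y → x ≡ y
⊑∧level≡⇒≡ {_ , k} x⊑y refl = cong (_, k) (⊑-sameLevel x⊑y)

aboveRow : ∀ {k w} → (∀ a → (a , k) ⊑ w) → 2 + k ≤ level w
aboveRow {w = x , _} above with others x
... | b , _ , x≢b , _ with above x | above b
...   | stay     | b⊑x = contradiction (sym (⊑-sameLevel b⊑x)) x≢b
...   | step x≢x | _   = contradiction refl x≢x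
...   | jump k<l | _   = k<l

belowRow : ∀ {k w} → (∀ a → w ⊑ (a , k)) → 2 + level w ≤ k
belowRow {w = x , _} below with others x
... | b , _ , x≢b , _ with below x | below b
...   | stay     | x⊑b = contradiction (⊑-sameLevel x⊑b) x≢b
...   | step x≢x | _   = contradiction refl x≢x
...   | jump k<l | _   = k<l

abstract
  -- If `t i` lay lower than `t j`, then `t j` would sit directly over `t i` in its column. The
  -- third member `t h` is either higher than `t i`, and then equals `t j`, or lower than `t j`, and
  -- then equals `t i`.
  antichain⇒row : (t : Fin 3 → Point) → (∀ i j → t i ⊑ t j → i ≡ j) →
                  ∃[ k ] (∀ i → level (t i) ≡ k) × (∀ a → ∃[ i ] t i ≡ (a , k))
  antichain⇒row t antichain = level (t zero) , sameLevel , cover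
    where
    level≮ : ∀ i j → ¬ level (t i) < level (t j)
    level≮ i j ti<tj with third i j
    ... | h , h≢i , h≢j with ti≢tj ← (λ ti≡tj → <-irrefl (cong level ti≡tj) ti<tj)
      with beyond (λ ti⊑tj → ti≢tj (cong t (antichain i j ti⊑tj))) ti<tj
         | level (t i) <? level (t h)
    ...   | tj≡ | yes ti<th = h≢j (antichain h j (subst (_⊑ t j)
      (trans tj≡ (sym (beyond (λ ti⊑th → h≢i (sym (antichain i h ti⊑th))) ti<th))) stay))
    ...   | tj≡ | no  ti≮th
      with beyond (λ th⊑tj → h≢j (antichain h j th⊑tj)) (≤-<-trans (≮⇒≥ ti≮th) ti<tj)
    ...     | tj≡′ with eq ← trans (sym tj≡) tj≡′ =
      h≢i (antichain h i (subst (t h ⊑_)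
        (cong₂ _,_ (sym (cong column eq)) (sym (suc-injective (cong level eq)))) stay))

    sameLevel : ∀ i → level (t i) ≡ level (t zero)
    sameLevel i = ≤-antisym (≮⇒≥ (level≮ zero i)) (≮⇒≥ (level≮ i zero))

    column-injective : ∀ {i j} → column (t i) ≡ column (t j) → i ≡ j
    column-injective {i} {j} eq = antichain i j (subst (t i ⊑_)
      (cong₂ _,_ eq (trans (sameLevel i) (sym (sameLevel j)))) stay)

    cover : ∀ a → ∃[ i ] t i ≡ (a , level (t zero))
    cover a = let i , eq = injective⇒surjective (column ∘ t) column-injective a in
      i , cong₂ _,_ eq (sameLevel i)

-- Towers of two-element antichains inside the crown.

_≼_ : Rel (ℕ × Fin 2) 0ℓ
s ≼ t = proj₁ s < proj₁ t ⊎ s ≡ t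

other : (β : Fin 2) → ∃[ γ ] β ≢ γ
other zero       = suc zero , λ ()
other (suc zero) = zero , λ ()

fin2-cover : {β γ : Fin 2} → β ≢ γ → ∀ δ → δ ≡ β ⊎ δ ≡ γ
fin2-cover {zero}     {zero}     β≢γ _          = contradiction refl β≢γ
fin2-cover {zero}     {suc zero} _   zero       = inj₁ refl
fin2-cover {zero}     {suc zero} _   (suc zero) = inj₂ refl
fin2-cover {suc zero} {zero}     _   zero       = inj₂ refl
fin2-cover {suc zero} {zero}     _   (suc zero) = inj₁ refl
fin2-cover {suc zero} {suc zero} β≢γ _          = contradiction refl β≢γ

module _
  (n K : ℕ) (e : ℕ → Fin 2 → Point) (g : Point → ℕ × Fin 2)
  (e-bounded : ∀ i β → level (e i β) ≤ n)
  (e-mono : ∀ {i j β γ} → i < j → j ≤ K → e i β ⊑ e j γ)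
  (g-bounded : ∀ x → proj₁ (g x) ≤ K)
  (g-mono : ∀ {x y} → x ⊑ y → level y ≤ n → g x ≼ g y)
  (g-e : ∀ {i β} → i ≤ K → g (e i β) ≡ (i , β))
  where

  -- The tower is made of the antichains {e i 0F , e i 1F}, i ≤ K; the values of
  -- e beyond K and of g beyond level n are junk.
  private
    rank : Point → ℕ
    rank x = proj₁ (g x)

    rank-mono : ∀ {x y} → x ⊑ y → level y ≤ n → rank x ≤ rank y
    rank-mono x⊑y y≤n with g-mono x⊑y y≤n
    ... | inj₁ gx<gy = <⇒≤ gx<gy
    ... | inj₂ gx≡gy = ≤-reflexive (cong proj₁ gx≡gy)

    e-level : ∀ {i β a k} → e i β ≡ (a , k) → k ≤ n
    e-level {i} {β} eᵢ≡x = subst (λ x → level x ≤ n) eᵢ≡x (e-bounded i β)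

    g-at : ∀ {i β x} → i ≤ K → e i β ≡ x → g x ≡ (i , β)
    g-at i≤K refl = g-e i≤K

    e-next : ∀ {i β γ x} → suc i ≤ K → e i β ≡ x → x ⊑ e (suc i) γ
    e-next i<K refl = e-mono ≤-refl i<K

    e-incomparable : ∀ {i β γ x} → i ≤ K → β ≢ γ → e i β ≡ x → ¬ x ⊑ e i γ
    e-incomparable {i} {β} {γ} i≤K β≢γ refl eβ⊑eγ
      with subst₂ _≼_ (g-e i≤K) (g-e i≤K) (g-mono eβ⊑eγ (e-bounded i γ))
    ... | inj₁ i<i  = <-irrefl refl i<i
    ... | inj₂ refl = β≢γ refl

    -- The two elements of pair `i` have no common upper bound inside the pair, so `g w` has to
    -- leave it upwards.
    raise : ∀ {i β γ x y w} → β ≢ γ → g x ≡ (i , β) → g y ≡ (i , γ) →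
            x ⊑ w → y ⊑ w → level w ≤ n → i < rank w
    raise {w = w} β≢γ gx≡ gy≡ x⊑w y⊑w w≤n
      with subst (_≼ g w) gx≡ (g-mono x⊑w w≤n) | subst (_≼ g w) gy≡ (g-mono y⊑w w≤n)
    ... | inj₁ i<w | _        = i<w
    ... | inj₂ _   | inj₁ i<w = i<w
    ... | inj₂ p   | inj₂ q   = contradiction (cong proj₂ (trans p (sym q))) β≢γ

    -- Monotonicity puts `g w` at or below `(i , β)`, and the bound on the rank rules out every
    -- earlier pair.
    pin : ∀ {i β x w} → i ≤ K → i ≤ rank w → w ⊑ x → e i β ≡ x → g w ≡ (i , β)
    pin {i} {β} {w = w} i≤K i≤w w⊑x refl with subst (g w ≼_) (g-e i≤K) (g-mono w⊑x (e-bounded i β))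
    ... | inj₁ w<i = contradiction i≤w (<⇒≱ w<i)
    ... | inj₂ gw≡ = gw≡

    -- A point below both elements of pair `i` would be pinned to two different values.
    escape : ∀ {i w} → i ≤ K → i ≤ rank w → ∃[ β ] ¬ w ⊑ e i β
    escape {i} {w} i≤K i≤w with w ⊑? e i zero | w ⊑? e i (suc zero)
    ... | no ⋢₀ | _     = zero , ⋢₀
    ... | yes _ | no ⋢₁ = suc zero , ⋢₁
    ... | yes ⊑₀ | yes ⊑₁
      with () ← trans (sym (pin i≤K i≤w ⊑₀ refl)) (pin i≤K i≤w ⊑₁ refl)

    -- A bound on the number of antichains above the i-th one.
    Fuel : ℕ → ℕ → Set
    Fuel d i = K ≤ d + i

    burn : ∀ d {i} → Fuel (suc d) i → Fuel d (suc i)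
    burn d {i} = subst (K ≤_) (sym (+-suc d i))

  -- The i-th pair is horizontal (deadRow) or vertical (deadColumn), and g sends
  -- the named points above it, so that another pair must follow, again of one of
  -- these two kinds: the tower could never end.
  private mutual
    deadRow : ∀ d {i k a b c β γ} → Fuel d i → Distinct a b c → β ≢ γ →
              e i β ≡ (b , k) → e i γ ≡ (c , k) → i < rank (a , k) → ⊥
    deadRow zero K≤i _ _ _ _ i<a = <⇒≱ i<a (≤-trans (g-bounded _) K≤i)
    deadRow (suc d) fuel D@(a≢b , a≢c , b≢c) β≢γ eβ eγ i<a
      with i<K ← ≤-trans i<a (g-bounded _)
      with δ , a⋢u ← escape i<K i<a
      with ε , δ≢ε ← other δ
      -- The element u that avoids `(a , k)` cannot lie two levels up, so it is `(a , suc k)`. Its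
      -- partner v, above the old pair but not above u, is `(a , 2 + k)`.
      with above-pair D (e-next i<K eβ) (e-next i<K eγ)
    ... | inj₂ 2+k≤u = contradiction (jump 2+k≤u) a⋢u
    ... | inj₁ u≡a =
      deadColumn d (burn d fuel) D δ≢ε u≡a v≡a (beyond-rank b≢c a≢b a≢c) (beyond-rank (≢-sym b≢c) a≢c a≢b)
      where
      v≡a = above-pair-avoiding D (e-next i<K eβ) (e-next i<K eγ)
              (e-incomparable i<K δ≢ε u≡a)
      level≤n = e-level v≡a

      -- `(x , 2 + k)` lies above u and above `(y , suc k)`. The latter is pinned to the value of v,
      -- since its rank is at least that of `(a , k)`.
      beyond-rank : ∀ {x y} → x ≢ y → _ ≢ x → _ ≢ y → suc _ < rank (x , 2 + _)
      beyond-rank x≢y a≢x a≢y = raise δ≢ε (g-at i<K u≡a)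
        (pin i<K (≤-trans i<a (rank-mono (step a≢y) (<⇒≤ level≤n)))
             (step (≢-sym a≢y)) v≡a)
        (step a≢x) (step (≢-sym x≢y)) level≤n

    deadColumn : ∀ d {i k a b c β γ} → Fuel d i → Distinct a b c → β ≢ γ →
                 e i β ≡ (a , k) → e i γ ≡ (a , suc k) →
                 i < rank (b , suc k) → i < rank (c , suc k) → ⊥
    deadColumn zero K≤i _ _ _ _ i<b _ = <⇒≱ i<b (≤-trans (g-bounded _) K≤i)
    deadColumn (suc d) fuel D@(a≢b , a≢c , b≢c) β≢γ eβ eγ i<b i<c
      with i<K ← ≤-trans i<b (g-bounded _)
      with δ , b⋢u ← escape i<K i<b
      with ε , c⋢v ← escape i<K i<c
      -- From level k + 2 on, `(b , suc k)` and `(c , suc k)` each miss only the point over them, so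
      -- the new pair is horizontal. Each of the two lies below the other's missed point and is
      -- pinned to it; `(a , 2 + k)` is above both.
      with u≡b ← beyond b⋢u (above-column (e-next i<K eβ) (e-next i<K eγ))
      with v≡c ← beyond c⋢v (above-column (e-next i<K eβ) (e-next i<K eγ)) =
      deadRow d (burn d fuel) D δ≢ε u≡b v≡c
        (raise δ≢ε (pin i<K i<c (step (≢-sym b≢c)) u≡b) (pin i<K i<b (step b≢c) v≡c)
               (step (≢-sym a≢c)) (step (≢-sym a≢b)) (e-level u≡b))
      where
      δ≢ε : δ ≢ ε
      δ≢ε refl = b≢c (cong proj₁ (trans (sym u≡b) v≡c))

  -- The configurations from which the tower may still end. The next pair is as
  -- shown by the mutual calls; every other choice leads to a dead configuration.
  private mutual
    aliveRow : ∀ d {i k a b c β γ} → Fuel d i → 3 ∣ k → Distinct a b c → β ≢ γ →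
               e i β ≡ (b , k) → e i γ ≡ (c , k) → g (a , k) ≡ (i , β) → 3 ∣ n
    aliveRow d {i} {k} {a} {b} {c} {β} {γ} fuel 3∣k D@(a≢b , a≢c , b≢c) β≢γ eβ eγ ga with k ≟ n
    ... | yes refl = 3∣k
    ... | no  k≢n  = advance d fuel
      where
      i≤K : i ≤ K
      i≤K = subst (_≤ K) (cong proj₁ ga) (g-bounded (a , k))

      k<n : k < n
      k<n = ≤∧≢⇒< (e-level eβ) k≢n

      i<a′ : i < rank (a , suc k)
      i<a′ = raise β≢γ (g-at i≤K eβ) (g-at i≤K eγ) (step (≢-sym a≢b)) (step (≢-sym a≢c)) k<n

      i<b′ : i < rank (b , suc k)
      i<b′ = raise β≢γ ga (g-at i≤K eγ) (step a≢b) (step (≢-sym b≢c)) k<n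

      i<K : i < K
      i<K = ≤-trans i<a′ (g-bounded _)

      -- The fuel is split only after the case k = n, because a row at level n may be the last pair,
      -- with no fuel left.
      advance : ∀ d → Fuel d i → 3 ∣ n
      advance zero    fuel = contradiction fuel (<⇒≱ i<K)
      advance (suc d) fuel
        with δ , a′⋢u ← escape i<K i<a′
        with ε , δ≢ε ← other δ
        -- The element u avoiding `(a , suc k)` is `(a , 2 + k)`, and `(b , suc k)` below it takes
        -- its value. The partner v decides: at `(a , suc k)` the tower goes on, anywhere else it is
        -- stuck.
        with u≡a ← above-pair-avoiding D (e-next i<K eβ) (e-next i<K eγ) a′⋢u
        with gb′ ← pin i<K i<b′ (step (≢-sym a≢b)) u≡a
        with above-pair D (e-next {γ = ε} i<K eβ) (e-next i<K eγ)
      ... | inj₁ v≡a = aliveColumn d (burn d fuel) (∣m∣n⇒∣m+n ∣-refl 3∣k) D (≢-sym δ≢ε) v≡a u≡a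
              (raise δ≢ε gb′ (g-at i<K v≡a) (step b≢c) (step a≢c) (e-level u≡a))
      ... | inj₂ 2+k≤v with notAbove D (e-incomparable i<K δ≢ε u≡a) 2+k≤v
      ...   | inj₁ v≡b = contradiction
              (raise δ≢ε gb′ (pin i<K i<a′ (step a≢b) v≡b) (step b≢c) (step a≢c) (e-level u≡a))
              (deadRow d (burn d fuel) (rotate D) δ≢ε u≡a v≡b)
      -- Here `(b , suc k)` would lie below both elements of the new pair.
      ...   | inj₂ (inj₁ v≡c) = contradiction
              (trans (sym gb′) (pin i<K i<b′ (step b≢c) v≡c)) (λ eq → δ≢ε (cong proj₂ eq))
      ...   | inj₂ (inj₂ v≡a) = contradiction
              (side (≢-sym b≢c) a≢c a≢b) (deadColumn d (burn d fuel) D δ≢ε u≡a v≡a (side b≢c a≢b a≢c))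
        where
        side : ∀ {x y} → x ≢ y → a ≢ x → a ≢ y → suc i < rank (x , 3 + k)
        side x≢y a≢x a≢y = raise δ≢ε (g-at i<K u≡a)
          (pin i<K (≤-trans i<a′ (rank-mono (step a≢y) (e-level u≡a))) (step (≢-sym a≢y)) v≡a)
          (step a≢x) (step (≢-sym x≢y)) (e-level v≡a)

    aliveColumn : ∀ d {i k a b c β γ} → Fuel d i → 3 ∣ 2 + k → Distinct a b c → β ≢ γ →
                  e i β ≡ (a , k) → e i γ ≡ (a , suc k) → i < rank (c , suc k) → 3 ∣ n
    aliveColumn zero fuel _ _ _ _ _ i<c = contradiction (≤-trans (g-bounded _) fuel) (<⇒≱ i<c)
    aliveColumn (suc d) {i} {k} fuel 3∣2+k D@(a≢b , a≢c , b≢c) β≢γ eβ eγ i<c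
      with i<K ← ≤-trans i<c (g-bounded _)
      with δ , c⋢u ← escape i<K i<c
      with ε , δ≢ε ← other δ
      with u≡c ← beyond c⋢u (above-column (e-next i<K eβ) (e-next i<K eγ))
      with notAbove (rotate D) (e-incomparable {γ = ε} i<K δ≢ε u≡c)
             (above-column (e-next i<K eβ) (e-next i<K eγ))
    ... | inj₁ v≡a = contradiction refl (step⁻ (subst (_ ⊑_) v≡a (e-next i<K eγ)))
    ... | inj₂ (inj₁ v≡b)
      with gc ← pin i<K i<c (step (≢-sym b≢c)) v≡b
      -- `(a , 2 + k)` lies above `(c , suc k)`, which has the value of `(b , 2 + k)`. Either it is
      -- sent past the new pair, giving a dead row, or it shares that value, as `aliveRow` requires.
      with subst (_≼ g (_ , 2 + k)) gc (g-mono (step (≢-sym a≢c)) (e-level v≡b))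
    ...   | inj₁ i′<a = contradiction i′<a (deadRow d (burn d fuel) D (≢-sym δ≢ε) v≡b u≡c)
    ...   | inj₂ ga   = aliveRow d (burn d fuel) 3∣2+k D (≢-sym δ≢ε) v≡b u≡c (sym ga)
    aliveColumn (suc d) {i} {k} fuel 3∣2+k D@(a≢b , a≢c , b≢c) β≢γ eβ eγ i<c
        | inj₂ (inj₂ v≡c) =
      contradiction (side (≢-sym a≢b) (≢-sym b≢c) (≢-sym a≢c))
        (deadColumn d (burn d fuel) (rotate D) δ≢ε u≡c v≡c (side a≢b (≢-sym a≢c) (≢-sym b≢c)))
      where
      side : ∀ {x y} → x ≢ y → _ ≢ x → _ ≢ y → suc i < rank (x , 3 + k)
      side x≢y c≢x c≢y = raise δ≢ε (g-at i<K u≡c)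
        (pin i<K (≤-trans i<c (rank-mono (step c≢y) (e-level u≡c))) (step (≢-sym c≢y)) v≡c)
        (step c≢x) (step (≢-sym x≢y)) (e-level v≡c)

  private
    fuel₀ : Fuel K 0
    fuel₀ = m≤m+n K 0

    -- If `(a , 0)` is sent past the bottom pair, the row is dead. Otherwise it shares the value of
    -- `(b , 0)` or `(c , 0)`, and the row is alive, after exchanging the two if necessary.
    startRow : ∀ {a b c β γ} → Distinct a b c → β ≢ γ →
               e 0 β ≡ (b , 0) → e 0 γ ≡ (c , 0) → 3 ∣ n
    startRow {a} {β = β} {γ} D β≢γ eβ eγ = byImage (g (a , 0)) refl
      where
      byImage : ∀ s → g (a , 0) ≡ s → 3 ∣ n
      byImage (suc _ , _) ga =
        contradiction (subst (0 <_) (sym (cong proj₁ ga)) z<s) (deadRow K fuel₀ D β≢γ eβ eγ)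
      byImage (zero , δ) ga with fin2-cover β≢γ δ
      ... | inj₁ refl = aliveRow K fuel₀ (3 ∣0) D β≢γ eβ eγ ga
      ... | inj₂ refl = aliveRow K fuel₀ (3 ∣0) (swap D) (≢-sym β≢γ) eγ eβ ga

    -- The partner of `(a , 0)` is on level 0 too or is `(a , 1)`, and a vertical pair at the bottom
    -- is dead.
    start : ∀ {a β γ} → β ≢ γ → e 0 β ≡ (a , 0) → 3 ∣ n
    start {a} {β} {γ} β≢γ eβ
      with b , c , D@(a≢b , a≢c , b≢c) ← others a
      with notAbove {w = e 0 γ} D (e-incomparable z≤n β≢γ eβ) z≤n
    ... | inj₁ eγ        = startRow (rotate D) β≢γ eβ eγ
    ... | inj₂ (inj₁ eγ) = startRow (rotate (swap D)) β≢γ eβ eγ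
    ... | inj₂ (inj₂ eγ) = contradiction
      (side (≢-sym b≢c) a≢c a≢b) (deadColumn K fuel₀ D β≢γ eβ eγ (side b≢c a≢b a≢c))
      where
      side : ∀ {x y} → x ≢ y → a ≢ x → a ≢ y → 0 < rank (x , 1)
      side x≢y a≢x a≢y = raise β≢γ (g-at z≤n eβ) (pin z≤n z≤n (step (≢-sym a≢y)) eγ)
        (step a≢x) (step (≢-sym x≢y)) (e-level eγ)

    common-lower : ∀ x y → 0 < level x → 0 < level y → ∃[ z ] z ⊑ x × z ⊑ y
    common-lower (a , _) (b , _) 0<k 0<l with third a b
    ... | c , c≢a , c≢b = (c , 0) , below c≢a 0<k , below c≢b 0<l
      where
      below : ∀ {d k} → c ≢ d → 0 < k → (c , 0) ⊑ (d , k)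
      below {k = suc zero}    c≢d _ = step c≢d
      below {k = suc (suc k)} _   _ = jump (s≤s (s≤s z≤n))

  3∣height : 3 ∣ n
  3∣height = byBottom (e 0 zero) (e 0 (suc zero)) refl refl
    where
    byBottom : ∀ x y → e 0 zero ≡ x → e 0 (suc zero) ≡ y → 3 ∣ n
    byBottom (_ , zero) _ eβ _ = start {γ = suc zero} (λ ()) eβ
    byBottom (_ , suc _) (_ , zero) _ eγ = start {γ = zero} (λ ()) eγ
    -- With neither element on level 0, a common lower bound there would be pinned to both.
    byBottom x@(_ , suc _) y@(_ , suc _) eβ eγ with common-lower x y z<s z<s
    ... | z , z⊑x , z⊑y
      with () ← trans (sym (pin z≤n z≤n z⊑x eβ)) (pin z≤n z≤n z⊑y eγ)

-- Posets and crown coordinates.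

module Order (P : FinPoset) where
  open FinPoset P public
    using (Carrier)
    renaming ( _≤_ to _≤ₚ_; _<_ to _<ₚ_; _≟_ to _≟ₚ_; _≤?_ to _≤ₚ?_
             ; ≤-refl to ≤ₚ-refl; ≤-trans to ≤ₚ-trans; ≤-antisym to ≤ₚ-antisym)

  ≤ₚ∧≮ₚ⇒≡ : ∀ {p q} → p ≤ₚ q → ¬ p <ₚ q → p ≡ q
  ≤ₚ∧≮ₚ⇒≡ {p} {q} p≤q p≮q with p ≟ₚ q
  ... | yes p≡q = p≡q
  ... | no  p≢q = contradiction (p≤q , p≢q) p≮q

  _<ₚ?_ : ∀ p q → Dec (p <ₚ q)
  p <ₚ? q = (p ≤ₚ? q) ×-dec ¬? (p ≟ₚ q)

  -- Every section contains pairs without a common bound. In a tower, a bound of such a pair must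
  -- lie in a different section, which controls where points are projected.
  UnboundedAbove UnboundedBelow : Carrier → Carrier → Set
  UnboundedAbove u v = ∀ q → u ≤ₚ q → ¬ v ≤ₚ q
  UnboundedBelow u v = ∀ q → q ≤ₚ u → ¬ q ≤ₚ v

-- An isomorphism with the crown cut at level n. `point` is total on the infinite crown, but only
-- its values up to level n are constrained.
record Coordinates (P : FinPoset) (n : ℕ) : Set where
  open Order P using (Carrier; _≤ₚ_)
  field
    point       : Point → Carrier
    coord       : Carrier → Point
    bounded     : ∀ p → level (coord p) ≤ n
    point-coord : ∀ p → point (coord p) ≡ p
    coord-point : ∀ x → level x ≤ n → coord (point x) ≡ x
    point-mono  : ∀ {x y} → x ⊑ y → level y ≤ n → point x ≤ₚ point y
    coord-mono  : ∀ {p q} → p ≤ₚ q → coord p ⊑ coord q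

clamp : ∀ K → ℕ → Fin (suc K)
clamp _       zero    = zero
clamp zero    (suc _) = zero
clamp (suc K) (suc i) = suc (clamp K i)

toℕ-clamp : ∀ {K i} → i ≤ K → toℕ (clamp K i) ≡ i
toℕ-clamp z≤n       = refl
toℕ-clamp (s≤s i≤K) = cong suc (toℕ-clamp i≤K)

clamp-toℕ : ∀ {K} (i : Fin (suc K)) → clamp K (toℕ i) ≡ i
clamp-toℕ zero            = refl
clamp-toℕ {suc K} (suc i) = cong suc (clamp-toℕ i)

-- Retracts as splittings.

module _ (P : FinPoset) {k} (S : Fin (suc k) → FinPoset) where
  open Order P using (Carrier; _≤ₚ_)

  Tower : Set
  Tower = Σ (Fin (suc k)) λ i → FinPoset.Carrier (S i)

  record Splitting : Set where
    field
      embed         : Tower → Carrier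
      project       : Carrier → Tower
      embed-mono    : ∀ {s t} → OrdinalSum≤ S s t → embed s ≤ₚ embed t
      project-mono  : ∀ {p q} → p ≤ₚ q → OrdinalSum≤ S (project p) (project q)
      project-embed : ∀ s → project (embed s) ≡ s

    Onto : Set
    Onto = ∀ p → ∃[ s ] embed s ≡ p

  -- `embed` inverts the isomorphism, and `project` is the retraction followed by it. If `embed`
  -- were onto, every element would lie in `Q`, against properness.
  retract⇒splitting : ∀ Q → IsRetract P Q → IsProper P Q → induced P Q ≅ ordinalSum S →
                      Σ Splitting λ σ → ¬ Splitting.Onto σ
  retract⇒splitting Q (f , f-mono , f∈Q , f-fix) proper (h , iso) =
    record
      { embed         = λ s → proj₁ (inv s)
      ; project       = λ p → h (f p , f∈Q p)
      ; embed-mono    = λ {s} {t} s≤t →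
          cancel (subst₂ (OrdinalSum≤ S) (sym (h-inv s)) (sym (h-inv t)) s≤t)
      ; project-mono  = λ p≤q → mono (f-mono p≤q)
      ; project-embed = λ s → proj₂ (surjective s) (f-fix (proj₁ (inv s)) (proj₂ (inv s)))
      }
    , λ onto → proper λ p → let s , es≡p = onto p in subst Q es≡p (proj₂ (inv s))
    where
    open IsOrderIsomorphism iso

    inv : Tower → Σ Carrier Q
    inv s = proj₁ (surjective s)

    h-inv : ∀ s → h (inv s) ≡ s
    h-inv s = proj₂ (surjective s) refl

  module _ (σ : Splitting) where
    open Splitting σ

    image : Pred Carrier 0ℓ
    image p = embed (project p) ≡ p

    image-isRetract : IsRetract P image
    image-isRetract =
        embed ∘ project
      , embed-mono ∘ project-mono
      , (λ p → cong embed (project-embed (project p)))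
      , λ _ p∈image → p∈image

    image-iso : induced P image ≅ ordinalSum S
    image-iso = project ∘ proj₁ , record
      { isOrderMonomorphism = record
        { isOrderHomomorphism = record
          { cong = cong project
          ; mono = project-mono
          }
        ; injective = λ {(_ , p∈)} {(_ , q∈)} πp≡πq →
            trans (sym p∈) (trans (cong embed πp≡πq) q∈)
        ; cancel = λ {(_ , p∈)} {(_ , q∈)} πp≤πq → subst₂ _≤ₚ_ p∈ q∈ (embed-mono πp≤πq)
        }
      ; surjective = λ s → (embed s , cong embed (project-embed s)) ,
          λ z≡es → trans (cong project z≡es) (project-embed s)
      }

-- Common bounds in sections and towers.

module Labelling {P : FinPoset} {n label} (labelling : IsCyclicLabelling P n label) where
  open Order P
  open IsCyclicLabelling labelling public

  label-injective : ∀ {x y} → Inverse.to label x ≡ Inverse.to label y → x ≡ y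
  label-injective {x} {y} eq = trans (sym (Inverse.strictlyInverseʳ label x))
    (trans (cong (Inverse.from label) eq) (Inverse.strictlyInverseʳ label y))

  column-mono : ∀ i {k l} → k Fin.≤ l → [ i , k ] ≤ₚ [ i , l ]
  column-mono i {k} {l} k≤l with k Fin.≟ l
  ... | yes refl = ≤ₚ-refl
  ... | no  k≢l  = proj₁ (increasing i k l (Fin.≤∧≢⇒< k≤l k≢l))

  row-≤⇒≡ : ∀ {i j k} → [ i , k ] ≤ₚ [ j , k ] → i ≡ j
  row-≤⇒≡ {i} {j} {k} i≤j =
    cong proj₁ (label-injective (≤ₚ∧≮ₚ⇒≡ i≤j (antichain k i j)))

  -- A common upper bound would lie below the top element of its own column, and in the top row that
  -- element is above itself only.
  row-unboundedAbove : ∀ {i j} → i ≢ j → UnboundedAbove [ i , fromℕ n ] [ j , fromℕ n ]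
  row-unboundedAbove {i} {j} i≢j q i≤q j≤q = i≢j (trans (row-≤⇒≡ (≤ₚ-trans i≤q q≤top))
                                                   (sym (row-≤⇒≡ (≤ₚ-trans j≤q q≤top))))
    where
    x = Inverse.from label q

    q≤top : q ≤ₚ [ proj₁ x , fromℕ n ]
    q≤top = subst (_≤ₚ [ proj₁ x , fromℕ n ]) (Inverse.strictlyInverseˡ label q) (column-mono (proj₁ x) (Fin.≤fromℕ (proj₂ x)))

  row-unboundedBelow : ∀ {i j} → i ≢ j → UnboundedBelow [ i , zero ] [ j , zero ]
  row-unboundedBelow {i} {j} i≢j q q≤i q≤j = i≢j (trans (sym (row-≤⇒≡ (≤ₚ-trans bottom≤q q≤i)))
                                                   (row-≤⇒≡ (≤ₚ-trans bottom≤q q≤j)))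
    where
    x = Inverse.from label q

    bottom≤q : [ proj₁ x , zero ] ≤ₚ q
    bottom≤q = subst ([ proj₁ x , zero ] ≤ₚ_) (Inverse.strictlyInverseˡ label q) (column-mono (proj₁ x) z≤n)

module _ {P : FinPoset} (A : IsTwoAntichain P) where
  open Order P
  open Inverse (proj₁ A)

  to-0≢1 : to zero ≢ to (suc zero)
  to-0≢1 eq with () ← trans (sym (strictlyInverseʳ zero))
                        (trans (cong from eq) (strictlyInverseʳ (suc zero)))

  antichain-≤⇒≡ : ∀ {p q} → p ≤ₚ q → p ≡ q
  antichain-≤⇒≡ p≤q = ≤ₚ∧≮ₚ⇒≡ p≤q (proj₂ A _ _)

section-unboundedAbove : ∀ {P} → IsSection P → ∃[ u ] ∃[ v ] Order.UnboundedAbove P u v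
section-unboundedAbove {P} (inj₁ A) = Inverse.to (proj₁ A) zero , Inverse.to (proj₁ A) (suc zero) , λ q u≤q v≤q →
  to-0≢1 {P} A (trans (antichain-≤⇒≡ {P} A u≤q) (sym (antichain-≤⇒≡ {P} A v≤q)))
section-unboundedAbove (inj₂ (_ , _ , _ , L)) =
  _ , _ , Labelling.row-unboundedAbove L {zero} {suc zero} (λ ())

section-unboundedBelow : ∀ {P} → IsSection P → ∃[ u ] ∃[ v ] Order.UnboundedBelow P u v
section-unboundedBelow {P} (inj₁ A) = Inverse.to (proj₁ A) zero , Inverse.to (proj₁ A) (suc zero) , λ q q≤u q≤v →
  to-0≢1 {P} A (trans (sym (antichain-≤⇒≡ {P} A q≤u)) (antichain-≤⇒≡ {P} A q≤v))
section-unboundedBelow (inj₂ (_ , _ , _ , L)) =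
  _ , _ , Labelling.row-unboundedBelow L {zero} {suc zero} (λ ())

module _ {k} {S : Fin (suc k) → FinPoset} where

  tower-injective : ∀ {i p q} → _≡_ {A = Σ (Fin (suc k)) λ i → FinPoset.Carrier (S i)} (i , p) (i , q) → p ≡ q
  tower-injective refl = refl

  within⁻ : ∀ {i p q} → OrdinalSum≤ S (i , p) (i , q) → FinPoset._≤_ (S i) p q
  within⁻ (across i<i) = contradiction i<i (<-irrefl refl)
  within⁻ (within p≤q) = p≤q

  above-unbounded : ∀ {i u v t} → Order.UnboundedAbove (S i) u v →
                    OrdinalSum≤ S (i , u) t → OrdinalSum≤ S (i , v) t → i Fin.< proj₁ t
  above-unbounded _         (across i<j) _            = i<j
  above-unbounded _         (within _)   (across i<j) = i<j
  above-unbounded unbounded (within u≤q) (within v≤q) = contradiction v≤q (unbounded _ u≤q)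

  below-unbounded : ∀ {i u v t} → Order.UnboundedBelow (S i) u v →
                    OrdinalSum≤ S t (i , u) → OrdinalSum≤ S t (i , v) → proj₁ t Fin.< i
  below-unbounded _         (across j<i) _            = j<i
  below-unbounded _         (within _)   (across j<i) = j<i
  below-unbounded unbounded (within q≤u) (within q≤v) = contradiction q≤v (unbounded _ q≤u)

-- Sections of a tower that splits off the crown.

module SplitCrown {P n} (C : Coordinates P n) {K} (S : Fin (suc K) → FinPoset)
                  (sections : ∀ i → IsSection (S i)) (σ : Splitting P S) where
  open Coordinates C
  open Splitting σ

  E : Tower P S → Point
  E s = coord (embed s)

  G : Point → Tower P S
  G x = project (point x)

  E-bounded : ∀ s → level (E s) ≤ n
  E-bounded s = bounded (embed s)

  E-mono : ∀ {s t} → OrdinalSum≤ S s t → E s ⊑ E t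
  E-mono s≤t = coord-mono (embed-mono s≤t)

  G-mono : ∀ {x y} → x ⊑ y → level y ≤ n → OrdinalSum≤ S (G x) (G y)
  G-mono x⊑y y≤n = project-mono (point-mono x⊑y y≤n)

  G-E : ∀ s → G (E s) ≡ s
  G-E s = trans (cong project (point-coord (embed s))) (project-embed s)

  ⊑E⇒G≤ : ∀ {x s} → x ⊑ E s → OrdinalSum≤ S (G x) s
  ⊑E⇒G≤ {x} {s} x⊑Es = subst (OrdinalSum≤ S (G x)) (G-E s) (G-mono x⊑Es (E-bounded s))

  E⊑⇒≤G : ∀ {x s} → E s ⊑ x → level x ≤ n → OrdinalSum≤ S s (G x)
  E⊑⇒≤G {x} {s} Es⊑x x≤n = subst (λ t → OrdinalSum≤ S t (G x)) (G-E s) (G-mono Es⊑x x≤n)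

  E-reflect : ∀ {s t} → E s ⊑ E t → OrdinalSum≤ S s t
  E-reflect {s} Es⊑Et = subst (λ r → OrdinalSum≤ S r _) (G-E s) (⊑E⇒G≤ Es⊑Et)

  E-injective : ∀ {s t} → E s ≡ E t → s ≡ t
  E-injective {s} {t} eq = trans (sym (G-E s)) (trans (cong G eq) (G-E t))

  module LargeSection {i m label} (L : IsCyclicLabelling (S i) m label) where
    open Labelling L
    open Order (S i) using (_<ₚ_)

    row : Fin (suc m) → Fin 3 → Point
    row j h = E (i , [ h , j ])

    row-antichain : ∀ j h h′ → row j h ⊑ row j h′ → h ≡ h′
    row-antichain j h h′ h⊑h′ = row-≤⇒≡ (within⁻ (E-reflect h⊑h′))

    IsRowAt : Fin (suc m) → ℕ → Set
    IsRowAt j l = (∀ h → level (row j h) ≡ l) × (∀ a → ∃[ h ] row j h ≡ (a , l))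

    rowLevel : ∀ j → ∃ (IsRowAt j)
    rowLevel j = antichain⇒row (row j) (row-antichain j)

    -- The level cannot stay the same, since `E` is injective, and it cannot grow by two, since then
    -- every element of the lower row would be below every element of the upper one, against
    -- `incomplete`.
    rowLevel-next : ∀ j {l} → IsRowAt (inject₁ j) l → IsRowAt (suc j) (suc l)
    rowLevel-next j {l} (level≡l , _) with rowLevel (suc j)
    ... | l′ , level≡l′ , full′ = subst (IsRowAt (suc j)) l′≡1+l (level≡l′ , full′)
      where
      s t : Tower P S
      s = i , [ zero , inject₁ j ]
      t = i , [ zero , suc j ]

      s<t : [ zero , inject₁ j ] <ₚ [ zero , suc j ]
      s<t = increasing zero (inject₁ j) (suc j) (Fin.≤̄⇒inject₁< Fin.≤-refl)

      Es⊑Et : E s ⊑ E t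
      Es⊑Et = E-mono (within (proj₁ s<t))

      l≢l′ : l ≢ l′
      l≢l′ l≡l′ = proj₂ s<t (tower-injective {S = S} (E-injective (⊑∧level≡⇒≡ Es⊑Et
        (trans (level≡l zero) (trans l≡l′ (sym (level≡l′ zero)))))))

      2+l≰l′ : ¬ 2 + l ≤ l′
      2+l≰l′ 2+l≤l′ with incomplete j
      ... | h , h′ , h≮h′ = h≮h′
        ( within⁻ (E-reflect (jump (subst₂ (λ k k′ → 2 + k ≤ k′)
            (sym (level≡l h)) (sym (level≡l′ h′)) 2+l≤l′)))
        , λ eq → l≢l′ (trans (sym (level≡l h))
            (trans (cong (λ p → level (E (i , p))) eq) (level≡l′ h′))) )

      l′≡1+l : l′ ≡ suc l
      l′≡1+l = ≤-antisym (≮⇒≥ 2+l≰l′) (≤∧≢⇒<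
        (subst₂ _≤_ (level≡l zero) (level≡l′ zero) (⊑⇒level≤ Es⊑Et)) l≢l′)

    -- If l < n, each point of level l + 1 is above two top elements of section `i` and so is
    -- projected past it. But section `i⁺` starts at level l + 2 or higher and has two elements
    -- without a common lower bound; a point of level l + 1 off their columns is below both, hence
    -- projected before `i⁺`.
    top : ∀ {l} → IsRowAt (fromℕ m) l → l ≡ n
    top {l} (level≡l , full) with l ≟ n
    ... | yes l≡n = l≡n
    ... | no  l≢n = contradiction impossible λ ()
      where
      l<n : l < n
      l<n = ≤∧≢⇒< (subst (_≤ n) (level≡l zero) (E-bounded _)) l≢n

      i<G : ∀ c → i Fin.< proj₁ (G (c , suc l))
      i<G c with others c
      ... | a , b , c≢a , c≢b , a≢b with full a | full b
      ...   | h , Eh | h′ , Eh′ = above-unbounded (row-unboundedAbove h≢h′) (below Eh c≢a) (below Eh′ c≢b)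
        where
        h≢h′ : h ≢ h′
        h≢h′ refl = a≢b (cong column (trans (sym Eh) Eh′))

        below : ∀ {h a} → row (fromℕ m) h ≡ (a , l) → c ≢ a →
                OrdinalSum≤ S (i , [ h , fromℕ m ]) (G (c , suc l))
        below Eh c≢a = E⊑⇒≤G (subst (_⊑ (c , suc l)) (sym Eh) (step (≢-sym c≢a))) l<n

      -- A section after `i` exists because the points of level l + 1 are projected to one, so the
      -- clamp changes nothing.
      i⁺ : Fin (suc K)
      i⁺ = clamp K (suc (toℕ i))

      toℕ-i⁺ : toℕ i⁺ ≡ suc (toℕ i)
      toℕ-i⁺ = toℕ-clamp (≤-trans (i<G zero) (Fin.toℕ≤pred[n] _))

      far : ∀ w → 2 + l ≤ level (E (i⁺ , w))
      far w = aboveRow λ a → let h , Eh = full a in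
        subst (_⊑ E (i⁺ , w)) Eh (E-mono (across (≤-reflexive (sym toℕ-i⁺))))

      impossible : ⊥
      impossible with section-unboundedBelow (sections i⁺)
      ... | u , v , unbounded with third (column (E (i⁺ , u))) (column (E (i⁺ , v)))
      ...   | c , c≢u , c≢v = <⇒≱ (i<G c) (s≤s⁻¹ (subst (_ <_) toℕ-i⁺ (below-unbounded unbounded
        (⊑E⇒G≤ (⊑-offColumn c≢u (far u))) (⊑E⇒G≤ (⊑-offColumn c≢v (far v))))))

    -- Dual to `top`: a point just under the row is projected before section `i`, yet can be chosen
    -- above two elements of section `i⁻` without a common upper bound.
    bottom : IsRowAt zero 0
    bottom with rowLevel zero
    ... | zero  , at = at
    ... | suc l , level≡1+l , full = contradiction impossible λ ()
      where
      l<n : l < n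
      l<n = subst (_≤ n) (level≡1+l zero) (E-bounded _)

      G<i : ∀ c → proj₁ (G (c , l)) Fin.< i
      G<i c with others c
      ... | a , b , c≢a , c≢b , a≢b with full a | full b
      ...   | h , Eh | h′ , Eh′ = below-unbounded (row-unboundedBelow h≢h′) (above Eh c≢a) (above Eh′ c≢b)
        where
        h≢h′ : h ≢ h′
        h≢h′ refl = a≢b (cong column (trans (sym Eh) Eh′))

        above : ∀ {h a} → row zero h ≡ (a , suc l) → c ≢ a →
                OrdinalSum≤ S (G (c , l)) (i , [ h , zero ])
        above Eh c≢a = ⊑E⇒G≤ (subst ((c , l) ⊑_) (sym Eh) (step c≢a))

      i⁻ : Fin (suc K)
      i⁻ = clamp K (pred (toℕ i))

      toℕ-i⁻ : suc (toℕ i⁻) ≡ toℕ i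
      toℕ-i⁻ = trans (cong suc (toℕ-clamp (≤-trans pred[n]≤n (Fin.toℕ≤pred[n] i))))
        (suc-pred (toℕ i) ⦃ >-nonZero (≤-trans (s≤s z≤n) (G<i zero)) ⦄)

      far : ∀ w → 2 + level (E (i⁻ , w)) ≤ suc l
      far w = belowRow λ a → let h , Eh = full a in
        subst (E (i⁻ , w) ⊑_) Eh (E-mono (across (≤-reflexive toℕ-i⁻)))

      impossible : ⊥
      impossible with section-unboundedAbove (sections i⁻)
      ... | u , v , unbounded with third (column (E (i⁻ , u))) (column (E (i⁻ , v)))
      ...   | c , c≢u , c≢v = <⇒≱ (G<i c) (subst (_≤ _) toℕ-i⁻ (above-unbounded unbounded
        (E⊑⇒≤G (⊑-offColumn (≢-sym c≢u) (s≤s⁻¹ (far u))) (<⇒≤ l<n))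
        (E⊑⇒≤G (⊑-offColumn (≢-sym c≢v) (s≤s⁻¹ (far v))) (<⇒≤ l<n))))

    -- Climb from `bottom` one row at a time; the rows cannot run out early because `top` puts the
    -- last one at level n.
    everyLevel : ∀ l → l ≤ n → ∃[ j ] IsRowAt j l
    everyLevel zero    _   = zero , bottom
    everyLevel (suc l) l<n with everyLevel l (<⇒≤ l<n)
    ... | j , at with view j
    ...   | ‵fromℕ     = contradiction (top at) (<⇒≢ l<n)
    ...   | ‵inject₁ j = suc j , rowLevel-next j at

    onto : Onto
    onto p with everyLevel (level (coord p)) (bounded p)
    ... | j , _ , full with full (column (coord p))
    ...   | h , Eh≡ = _ , trans (sym (point-coord _)) (trans (cong point Eh≡) (point-coord p))

  sections⇒antichains : ¬ Onto → ∀ i → IsTwoAntichain (S i)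
  sections⇒antichains ¬onto i with sections i
  ... | inj₁ A = A
  ... | inj₂ (_ , _ , _ , L) = contradiction (LargeSection.onto L) ¬onto

  module AntichainTower (antichain : ∀ i → IsTwoAntichain (S i)) where
    module Pair i = Inverse (proj₁ (antichain i))

    e : ℕ → Fin 2 → Point
    e i β = E (clamp K i , Pair.to _ β)

    g : Point → ℕ × Fin 2
    g x = toℕ (proj₁ (G x)) , Pair.from _ (proj₂ (G x))

    e-mono : ∀ {i j β γ} → i < j → j ≤ K → e i β ⊑ e j γ
    e-mono i<j j≤K = E-mono (across (subst₂ _<_
      (sym (toℕ-clamp (<⇒≤ (≤-trans i<j j≤K)))) (sym (toℕ-clamp j≤K)) i<j))

    g-bounded : ∀ x → proj₁ (g x) ≤ K
    g-bounded x = Fin.toℕ≤pred[n] (proj₁ (G x))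

    g-mono : ∀ {x y} → x ⊑ y → level y ≤ n → g x ≼ g y
    g-mono x⊑y y≤n = flatten (G-mono x⊑y y≤n)
      where
      flatten : ∀ {i j p q} → OrdinalSum≤ S (i , p) (j , q) →
                (toℕ i , Pair.from i p) ≼ (toℕ j , Pair.from j q)
      flatten (across i<j)     = inj₁ i<j
      flatten (within {i} p≤q) = inj₂ (cong (λ p → toℕ i , Pair.from i p) (antichain-≤⇒≡ {S i} (antichain i) p≤q))

    g-e : ∀ {i β} → i ≤ K → g (e i β) ≡ (i , β)
    g-e {i} {β} i≤K rewrite G-E (clamp K i , Pair.to _ β) =
      cong₂ _,_ (toℕ-clamp i≤K) (Pair.strictlyInverseʳ _ β)

  3∣rank : ¬ Onto → 3 ∣ n
  3∣rank ¬onto = 3∣height n K e g (λ _ _ → E-bounded _) e-mono g-bounded g-mono g-e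
    where open AntichainTower (sections⇒antichains ¬onto)

-- The period-three retract.

antichain₂ : FinPoset
antichain₂ = record
  { Carrier           = Fin 2
  ; _≤_               = _≡_
  ; isDecPartialOrder = record
    { isPartialOrder = isPartialOrder
    ; _≟_            = Fin._≟_
    ; _≤?_           = Fin._≟_
    }
  ; size              = 2
  ; enumeration       = ↔-id (Fin 2)
  }

antichain₂-isTwoAntichain : IsTwoAntichain antichain₂
antichain₂-isTwoAntichain = ↔-id (Fin 2) , λ _ _ p<q → proj₂ p<q (proj₁ p<q)

shift : Point → Point
shift (a , k) = a , 3 + k

shift-mono : ∀ {x y} → x ⊑ y → shift x ⊑ shift y
shift-mono stay       = stay
shift-mono (step a≢b) = step a≢b
shift-mono (jump k<l) = jump (+-monoʳ-≤ 3 k<l)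

raise₂ : ℕ × Fin 2 → ℕ × Fin 2
raise₂ (i , β) = 2 + i , β

raise₂-mono : ∀ {s t} → s ≼ t → raise₂ s ≼ raise₂ t
raise₂-mono (inj₁ i<j)  = inj₁ (+-monoʳ-< 2 i<j)
raise₂-mono (inj₂ refl) = inj₂ refl

-- wrap i enumerates the i-th pair of the period-three retract, and fold
-- followed by wrap is the retraction.
wrap : ℕ → Fin 2 → Point
wrap 0             0F = 0F , 0
wrap 0             1F = 1F , 0
wrap 1             0F = 2F , 1
wrap 1             1F = 2F , 2
wrap (suc (suc i)) β  = shift (wrap i β)

foldAt : ℕ → Fin 3 → ℕ × Fin 2
foldAt 0 0F = 0 , 0F
foldAt 0 1F = 0 , 1F
foldAt 0 2F = 0 , 0F
foldAt 1 0F = 1 , 1F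
foldAt 1 1F = 0 , 0F
foldAt 1 2F = 1 , 0F
foldAt 2 0F = 1 , 0F
foldAt 2 1F = 2 , 0F
foldAt 2 2F = 1 , 1F
foldAt (suc (suc (suc k))) a = raise₂ (foldAt k a)

fold : Point → ℕ × Fin 2
fold (a , k) = foldAt k a

fold-wrap : ∀ i β → fold (wrap i β) ≡ (i , β)
fold-wrap 0             0F = refl
fold-wrap 0             1F = refl
fold-wrap 1             0F = refl
fold-wrap 1             1F = refl
fold-wrap (suc (suc i)) β  = cong raise₂ (fold-wrap i β)

wrap-level : ∀ m {i} β → i ≤ m * 2 → level (wrap i β) ≤ m * 3
wrap-level m       {0} 0F _ = z≤n
wrap-level m       {0} 1F _ = z≤n
wrap-level (suc m) {1} 0F _ = s≤s z≤n
wrap-level (suc m) {1} 1F _ = s≤s (s≤s z≤n)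
wrap-level (suc m) {suc (suc i)} β (s≤s (s≤s i≤2m)) = +-monoʳ-≤ 3 (wrap-level m β i≤2m)

-- On the third level of a block `foldAt` may point into the next block. As 3m is the first level of
-- a block, the pair pointed to is still present.
fold-rank : ∀ m a {k} → k ≤ m * 3 → proj₁ (fold (a , k)) ≤ m * 2
fold-rank m       0F {0} _ = z≤n
fold-rank m       1F {0} _ = z≤n
fold-rank m       2F {0} _ = z≤n
fold-rank (suc m) 0F {1} _ = s≤s z≤n
fold-rank (suc m) 1F {1} _ = z≤n
fold-rank (suc m) 2F {1} _ = s≤s z≤n
fold-rank (suc m) 0F {2} _ = s≤s z≤n
fold-rank (suc m) 1F {2} _ = s≤s (s≤s z≤n)
fold-rank (suc m) 2F {2} _ = s≤s z≤n
fold-rank (suc m) a {suc (suc (suc k))} (s≤s (s≤s (s≤s k≤3m))) = +-monoʳ-≤ 2 (fold-rank m a k≤3m)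

wrap-mono : ∀ {i j} β γ → i < j → wrap i β ⊑ wrap j γ
wrap-mono {0} {1} 0F 0F _ = step λ ()
wrap-mono {0} {1} 0F 1F _ = jump ≤-refl
wrap-mono {0} {1} 1F 0F _ = step λ ()
wrap-mono {0} {1} 1F 1F _ = jump ≤-refl
wrap-mono {0} {suc (suc j)} 0F γ _ = jump (s≤s (s≤s z≤n))
wrap-mono {0} {suc (suc j)} 1F γ _ = jump (s≤s (s≤s z≤n))
wrap-mono {1} {suc (suc j)} 0F γ _ = jump (s≤s (s≤s (s≤s z≤n)))
wrap-mono {1} {2} 1F 0F _ = step λ ()
wrap-mono {1} {2} 1F 1F _ = step λ ()
wrap-mono {1} {3} 1F 0F _ = jump ≤-refl
wrap-mono {1} {3} 1F 1F _ = jump (n≤1+n 4)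
wrap-mono {1} {suc (suc (suc (suc j)))} 1F γ _ = jump (s≤s (s≤s (s≤s (s≤s z≤n))))
wrap-mono {1} {1} _ _ (s≤s ())
wrap-mono {suc (suc i)} {suc (suc j)} β γ i<j = shift-mono (wrap-mono β γ (+-cancelˡ-< 2 i j i<j))
wrap-mono {suc (suc i)} {1} _ _ (s≤s ())

fold-rank-positive : ∀ a l → 1 ≤ proj₁ (fold (a , 2 + l))
fold-rank-positive 0F zero    = ≤-refl
fold-rank-positive 1F zero    = n≤1+n 1
fold-rank-positive 2F zero    = ≤-refl
fold-rank-positive a  (suc l) = s≤s z≤n

fold-step : ∀ {a b} k → a ≢ b → fold (a , k) ≼ fold (b , suc k)
fold-step {a} {b} (suc (suc (suc k))) a≢b = raise₂-mono (fold-step k a≢b)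
fold-step {0F} {0F} _ a≢a = contradiction refl a≢a
fold-step {1F} {1F} _ a≢a = contradiction refl a≢a
fold-step {2F} {2F} _ a≢a = contradiction refl a≢a
fold-step {0F} {1F} 0 _ = inj₂ refl
fold-step {0F} {2F} 0 _ = inj₁ ≤-refl
fold-step {1F} {0F} 0 _ = inj₁ ≤-refl
fold-step {1F} {2F} 0 _ = inj₁ ≤-refl
fold-step {2F} {0F} 0 _ = inj₁ ≤-refl
fold-step {2F} {1F} 0 _ = inj₂ refl
fold-step {0F} {1F} 1 _ = inj₁ ≤-refl
fold-step {0F} {2F} 1 _ = inj₂ refl
fold-step {1F} {0F} 1 _ = inj₁ ≤-refl
fold-step {1F} {2F} 1 _ = inj₁ ≤-refl
fold-step {2F} {0F} 1 _ = inj₂ refl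
fold-step {2F} {1F} 1 _ = inj₁ ≤-refl
fold-step {0F} {1F} 2 _ = inj₁ ≤-refl
fold-step {0F} {2F} 2 _ = inj₁ ≤-refl
fold-step {1F} {0F} 2 _ = inj₂ refl
fold-step {1F} {2F} 2 _ = inj₂ refl
fold-step {2F} {0F} 2 _ = inj₁ ≤-refl
fold-step {2F} {1F} 2 _ = inj₁ ≤-refl

-- The upper level has the form `k + (2 + l)` so that whole blocks peel off by computation. Up to a
-- shift by blocks, only the jump from `(1F , 2)` to `(1F , 4)` fails to raise the rank, and there
-- the images agree.
fold-jump : ∀ a b k l → fold (a , k) ≼ fold (b , k + (2 + l))
fold-jump a b (suc (suc (suc k))) l = raise₂-mono (fold-jump a b k l)
fold-jump 0F b 0 l = inj₁ (fold-rank-positive b l)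
fold-jump 1F b 0 l = inj₁ (fold-rank-positive b l)
fold-jump 2F b 0 l = inj₁ (fold-rank-positive b l)
fold-jump 0F b 1 l = inj₁ (s≤s (s≤s z≤n))
fold-jump 1F b 1 l = inj₁ (s≤s z≤n)
fold-jump 2F b 1 l = inj₁ (s≤s (s≤s z≤n))
fold-jump 0F b 2 l = inj₁ (s≤s (s≤s z≤n))
fold-jump 2F b 2 l = inj₁ (s≤s (s≤s z≤n))
fold-jump 1F 0F 2 0 = inj₁ ≤-refl
fold-jump 1F 1F 2 0 = inj₂ refl
fold-jump 1F 2F 2 0 = inj₁ ≤-refl
fold-jump 1F b 2 (suc l) = inj₁ (s≤s (s≤s (fold-rank-positive b l)))

fold-mono : ∀ {x y} → x ⊑ y → fold x ≼ fold y
fold-mono stay               = inj₂ refl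
fold-mono {_ , k} (step a≢b) = fold-step k a≢b
fold-mono {a , k} {b , l} (jump k<l) =
  subst (λ j → fold (a , k) ≼ fold (b , j)) k+2+d≡l (fold-jump a b k d)
  where
  d = l ∸ (2 + k)

  k+2+d≡l : k + (2 + d) ≡ l
  k+2+d≡l = trans (+-suc k (suc d)) (trans (cong suc (+-suc k d)) (m+[n∸m]≡n k<l))

module _ {P m} (C : Coordinates P (m * 3)) where
  open Order P
  open Coordinates C

  antichains : Fin (suc (m * 2)) → FinPoset
  antichains _ = antichain₂

  private
    embed : Tower P antichains → Carrier
    embed (i , β) = point (wrap (toℕ i) β)

    project : Carrier → Tower P antichains
    project p = clamp (m * 2) (proj₁ (fold (coord p))) , proj₂ (fold (coord p))

    rank≤ : ∀ p → proj₁ (fold (coord p)) ≤ m * 2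
    rank≤ p = fold-rank m _ (bounded p)

    wrap≤ : ∀ (i : Fin (suc (m * 2))) β → level (wrap (toℕ i) β) ≤ m * 3
    wrap≤ i β = wrap-level m β (Fin.toℕ≤pred[n] i)

    embed-mono : ∀ {s t} → OrdinalSum≤ antichains s t → embed s ≤ₚ embed t
    embed-mono (across {j = j} {q = γ} i<j) = point-mono (wrap-mono _ γ i<j) (wrap≤ j γ)
    embed-mono (within refl) = ≤ₚ-refl

    project-mono : ∀ {p q} → p ≤ₚ q → OrdinalSum≤ antichains (project p) (project q)
    project-mono {p} {q} p≤q with fold-mono (coord-mono p≤q)
    ... | inj₁ i<j = across (subst₂ _<_ (sym (toℕ-clamp (rank≤ p))) (sym (toℕ-clamp (rank≤ q))) i<j)
    ... | inj₂ eq rewrite eq = within refl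

    project-embed : ∀ s → project (embed s) ≡ s
    project-embed (i , β)
      rewrite coord-point (wrap (toℕ i) β) (wrap≤ i β) | fold-wrap (toℕ i) β =
      cong (_, β) (clamp-toℕ i)

  wrapping : Splitting P antichains
  wrapping = record
    { embed         = embed
    ; project       = project
    ; embed-mono    = embed-mono
    ; project-mono  = project-mono
    ; project-embed = project-embed
    }

  -- The point `(2F , 0)` is outside the image, being moved to `(0F , 0)`.
  wrapping-proper : IsProper P (image P antichains wrapping)
  wrapping-proper universal with () ← trans (sym (coord-point (2F , 0) z≤n))
    (trans (cong coord (sym (universal (point (2F , 0)))))
      (trans (cong (coord ∘ embed ∘ λ x → clamp (m * 2) (proj₁ (fold x)) , proj₂ (fold x))
               (coord-point (2F , 0) z≤n))
             (coord-point (0F , 0) z≤n)))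

  multiple⇒¬veryNice : ¬ IsVeryNice P
  multiple⇒¬veryNice veryNice = veryNice (image P antichains wrapping)
    (image-isRetract P antichains wrapping) wrapping-proper
    (m * 2 , antichains , (λ _ → inj₁ antichain₂-isTwoAntichain) , image-iso P antichains wrapping)

-- Maximal chains and coordinates of a ranked nice section.

AllPairs-discharge : ∀ {A : Set} {R : Rel A 0ℓ} {Q : Pred A 0ℓ} {xs} →
                     AllPairs (λ x y → Q x → Q y → R x y) xs → All Q xs → AllPairs R xs
AllPairs-discharge []       []       = []
AllPairs-discharge (r ∷ rs) (q ∷ qs) =
  All.zipWith (λ (r , q′) → r q q′) (r , qs) ∷ AllPairs-discharge rs qs

module Chains (P : FinPoset) where
  open Order P
  private module T = ToStrict _≡_ _≤ₚ_

  <ₚ-trans : Transitive _<ₚ_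
  <ₚ-trans = T.<-trans (FinPoset.isPartialOrder P)

  <ₚ-≤ₚ-trans : ∀ {p q s} → p <ₚ q → q ≤ₚ s → p <ₚ s
  <ₚ-≤ₚ-trans = T.<-≤-trans sym ≤ₚ-trans ≤ₚ-antisym (λ { refl → λ z → z })

  ≤ₚ-<ₚ-trans : ∀ {p q s} → p ≤ₚ q → q <ₚ s → p <ₚ s
  ≤ₚ-<ₚ-trans = T.≤-<-trans ≤ₚ-trans ≤ₚ-antisym (λ { refl → λ z → z })

  Comparable : Rel Carrier 0ℓ
  Comparable p q = p ≡ q ⊎ p <ₚ q ⊎ q <ₚ p

  chain-comparable : ∀ {c p q} → IsChain P c → p ∈ c → q ∈ c → Comparable p q
  chain-comparable = pairs ∘ Linked⇒AllPairs <ₚ-trans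
    where
    pairs : ∀ {c p q} → AllPairs _<ₚ_ c → p ∈ c → q ∈ c → Comparable p q
    pairs (_ ∷ _)   (here refl) (here refl) = inj₁ refl
    pairs (p< ∷ _)  (here refl) (there q∈)  = inj₂ (inj₁ (All.lookup p< q∈))
    pairs (q< ∷ _)  (there p∈)  (here refl) = inj₂ (inj₂ (All.lookup q< p∈))
    pairs (_ ∷ rs)  (there p∈)  (there q∈)  = pairs rs p∈ q∈

next³ : ∀ i → next (next (next i)) ≡ i
next³ 0F = refl
next³ 1F = refl
next³ 2F = refl

next-≢ : ∀ i → next i ≢ i
next-≢ 0F ()
next-≢ 1F ()
next-≢ 2F ()

orbit : ∀ i x → x ≡ i ⊎ x ≡ next i ⊎ x ≡ next (next i)
orbit i = distinct-cover _ _ _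
  (≢-sym (next-≢ i) , (λ eq → next-≢ i (trans (cong next eq) (next³ i))) , ≢-sym (next-≢ (next i)))

module NiceRankedSection {P : FinPoset} {r} (ranked : IsRankedOfRank P r) (nice : IsNice P)
                         {n label} (L : IsCyclicLabelling P n label) where
  open Order P
  open Chains P
  open Labelling {P} L

  labelled : ∀ p → ∃[ i ] ∃[ k ] [ i , k ] ≡ p
  labelled p = _ , _ , Inverse.strictlyInverseˡ label p

  <ₚ⇒level< : ∀ {i j k l} → [ i , k ] <ₚ [ j , l ] → k Fin.< l
  <ₚ⇒level< {i} {j} {k} {l} p<q with toℕ k <? toℕ l
  ... | yes k<l = k<l
  ... | no  k≮l = contradiction (<ₚ-≤ₚ-trans p<q (column-mono j (≮⇒≥ k≮l))) (antichain k i j)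

  -- A chain with one element in each row of `G`. As rows are antichains, an element of such a row
  -- comparable to the chosen one equals it, so `maximal` only has to exclude the other rows.
  module _ (γ : Fin (suc n) → Fin 3) {G : Pred (Fin (suc n)) 0ℓ} (G? : Unary.Decidable G)
           (increases : ∀ {j k} → j Fin.< k → G j → G k → [ γ j , j ] <ₚ [ γ k , k ])
           (maximal : ∀ i k → (∀ j → G j → Comparable [ i , k ] [ γ j , j ]) → G k)
           where

    private
      levels : List (Fin (suc n))
      levels = filter G? (allFin (suc n))

      chain : List Carrier
      chain = map (λ j → [ γ j , j ]) levels

      isChain : IsChain P chain
      isChain = AllPairs⇒Linked (AllPairs.map⁺ (AllPairs-discharge
        (AllPairs.filter⁺ G? (AllPairs.tabulate⁺-< increases)) (all-filter G? _)))

      chain∋ : ∀ j → G j → [ γ j , j ] ∈ chain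
      chain∋ j Gj = ∈-map⁺ _ (∈-filter⁺ G? (∈-allFin j) Gj)

      contains : ∀ d → IsChain P d → chain ⊆ d → ∀ i k → [ i , k ] ∈ d → [ i , k ] ∈ chain
      contains d d-chain c⊆d i k p∈d = at (comparable k Gk)
        where
        comparable : ∀ j → G j → Comparable [ i , k ] [ γ j , j ]
        comparable j Gj = chain-comparable d-chain p∈d (c⊆d (chain∋ j Gj))

        Gk : G k
        Gk = maximal i k comparable

        at : Comparable [ i , k ] [ γ k , k ] → [ i , k ] ∈ chain
        at (inj₁ eq)         = subst (_∈ chain) (sym eq) (chain∋ k Gk)
        at (inj₂ (inj₁ p<q)) = contradiction p<q (antichain k i (γ k))
        at (inj₂ (inj₂ q<p)) = contradiction q<p (antichain k (γ k) i)

    maximalChain-length : length levels ≡ suc r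
    maximalChain-length = trans (sym (length-map _ levels)) (ranked chain (isChain , λ d d-chain c⊆d {p} p∈d →
      let i , k , eq = labelled p in
      subst (_∈ chain) eq (contains d d-chain c⊆d i k (subst (_∈ d) (sym eq) p∈d))))

  -- Column 0 is a maximal chain with an element in every row.
  rank≡n : r ≡ n
  rank≡n = suc-injective (trans (sym (maximalChain-length (λ _ → 0F) {G = λ _ → ⊤} (λ _ → yes tt)
      (λ {j} {k} j<k _ _ → increasing 0F j k j<k) (λ _ _ _ → tt)))
    (trans (cong length (filter-all (λ _ → yes tt) (All.universal (λ _ → tt) (allFin (suc n)))))
           (length-tabulate {n = suc n} (λ j → j))))

  -- Otherwise following column a up to row k and column b from row l on gives a
  -- maximal chain that is shorter than a full column.
  refine : ∀ {a b k l} → [ a , k ] <ₚ [ b , l ] → suc (toℕ k) < toℕ l →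
           ∃[ i ] ∃[ j ] [ a , k ] <ₚ [ i , j ] × [ i , j ] <ₚ [ b , l ]
  refine {a} {b} {k} {l} p<q 1+k<l
    with Fin.any? (λ i → Fin.any? λ j → ([ a , k ] <ₚ? [ i , j ]) ×-dec ([ i , j ] <ₚ? [ b , l ]))
  ... | yes between = between
  ... | no  ¬between = contradiction
    -- By rankedness the chain has n + 1 elements, but it skips row `gap` among n + 1 rows.
    (subst₂ _<_ (trans (maximalChain-length γ G? increases maximal) (cong suc rank≡n))
       (length-tabulate {n = suc n} (λ j → j))
       (filter-notAll G? (allFin (suc n)) (lose (∈-allFin gap) ¬Ggap)))
    (<-irrefl refl)
    where
    G : Pred (Fin (suc n)) 0ℓ
    G j = j Fin.≤ k ⊎ l Fin.≤ j

    G? : Unary.Decidable G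
    G? j = (j Fin.≤? k) ⊎-dec (l Fin.≤? j)

    gap<n : suc (toℕ k) < suc n
    gap<n = <-trans 1+k<l (Fin.toℕ<n l)

    gap : Fin (suc n)
    gap = fromℕ< gap<n

    ¬Ggap : ¬ G gap
    ¬Ggap (inj₁ gap≤k) = 1+n≰n (subst (_≤ toℕ k) (Fin.toℕ-fromℕ< gap<n) gap≤k)
    ¬Ggap (inj₂ l≤gap) = <⇒≱ 1+k<l (subst (toℕ l ≤_) (Fin.toℕ-fromℕ< gap<n) l≤gap)

    γ : Fin (suc n) → Fin 3
    γ j with j Fin.≤? k
    ... | yes _ = a
    ... | no  _ = b

    increases : ∀ {i j} → i Fin.< j → G i → G j → [ γ i , i ] <ₚ [ γ j , j ]
    increases {i} {j} i<j Gi Gj with i Fin.≤? k | j Fin.≤? k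
    ... | yes _   | yes _   = increasing a i j i<j
    ... | no  _   | no  _   = increasing b i j i<j
    ... | no  i≰k | yes j≤k = contradiction (≤-trans (<⇒≤ i<j) j≤k) i≰k
    ... | yes i≤k | no  j≰k with Gj
    ...   | inj₁ j≤k = contradiction j≤k j≰k
    ...   | inj₂ l≤j = ≤ₚ-<ₚ-trans (column-mono a i≤k) (<ₚ-≤ₚ-trans p<q (column-mono b l≤j))

    γ-lower : γ k ≡ a
    γ-lower with k Fin.≤? k
    ... | yes _   = refl
    ... | no  k≰k = contradiction ≤-refl k≰k

    γ-upper : γ l ≡ b
    γ-upper with l Fin.≤? k
    ... | yes l≤k = contradiction (≤-trans (<⇒≤ 1+k<l) l≤k) 1+n≰n
    ... | no  _   = refl

    maximal : ∀ i j → (∀ h → G h → Comparable [ i , j ] [ γ h , h ]) → G j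
    maximal i j comparable with G? j
    ... | yes Gj = Gj
    ... | no ¬Gj = contradiction
      ( i , j
      , above (subst (λ x → Comparable [ i , j ] [ x , k ]) γ-lower (comparable k (inj₁ ≤-refl)))
      , below (subst (λ x → Comparable [ i , j ] [ x , l ]) γ-upper (comparable l (inj₂ ≤-refl))))
      ¬between
      where
      above : Comparable [ i , j ] [ a , k ] → [ a , k ] <ₚ [ i , j ]
      above (inj₁ eq)         = contradiction (inj₁ (≤-reflexive (cong (toℕ ∘ proj₂) (label-injective eq)))) ¬Gj
      above (inj₂ (inj₁ p<q)) = contradiction (inj₁ (<⇒≤ (<ₚ⇒level< p<q))) ¬Gj
      above (inj₂ (inj₂ q<p)) = q<p

      below : Comparable [ i , j ] [ b , l ] → [ i , j ] <ₚ [ b , l ]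
      below (inj₁ eq)         = contradiction (inj₂ (≤-reflexive (sym (cong (toℕ ∘ proj₂) (label-injective eq))))) ¬Gj
      below (inj₂ (inj₁ p<q)) = p<q
      below (inj₂ (inj₂ q<p)) = contradiction (inj₂ (<⇒≤ (<ₚ⇒level< q<p))) ¬Gj

  -- Niceness gives some s above `[ a , k ]` but not above `[ a , k⁺ ]`. Refining downwards keeps
  -- both properties until row `k⁺` is reached, where the second one excludes column `a`.
  upperCover : ∀ a {k k⁺} → toℕ k⁺ ≡ suc (toℕ k) → ∃[ b ] b ≢ a × [ a , k ] <ₚ [ b , k⁺ ]
  upperCover a {k} {k⁺} k⁺≡1+k
    with (s , p<s , q≰s) , _ ← nice [ a , k ] [ a , k⁺ ] (increasing a k k⁺ (≤-reflexive (sym k⁺≡1+k)))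
    with b , l , refl ← labelled s = descend (toℕ l) ≤-refl p<s q≰s
    where
    descend : ∀ d {b l} → toℕ l ≤ d → [ a , k ] <ₚ [ b , l ] → ¬ [ a , k⁺ ] ≤ₚ [ b , l ] →
              ∃[ b ] b ≢ a × [ a , k ] <ₚ [ b , k⁺ ]
    descend d {b} {l} l≤d p<s q≰s with toℕ l ≟ suc (toℕ k)
    ... | yes l≡1+k with refl ← Fin.toℕ-injective (trans l≡1+k (sym k⁺≡1+k)) =
      b , (λ { refl → q≰s ≤ₚ-refl }) , p<s
    descend zero    l≤d p<s q≰s | no _ = contradiction (≤-trans (<ₚ⇒level< p<s) l≤d) λ ()
    descend (suc d) l≤d p<s q≰s | no l≢1+k
      with _ , _ , p<t , t<s ← refine p<s (≤∧≢⇒< (<ₚ⇒level< p<s) (≢-sym l≢1+k)) =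
      descend d (s≤s⁻¹ (≤-trans (<ₚ⇒level< t<s) l≤d)) p<t (λ q≤t → q≰s (≤ₚ-trans q≤t (proj₁ t<s)))

  row : ℕ → Fin 3 → Carrier
  row k i = [ i , clamp n k ]

  -- τ matches each element of row k with the only element of row k + 1 that is not above it.
  record Matching (k : ℕ) : Set where
    field
      τ           : Fin 3 → Fin 3
      τ-injective : Injective _≡_ _≡_ τ
      unmatched   : ∀ {i j} → j ≢ τ i → row k i <ₚ row (suc k) j
      matched     : ∀ {i} → ¬ row k i <ₚ row (suc k) (τ i)

  -- Condition `incomplete`, rotated by `cyclic`, gives each element a missing one in the next row.
  -- Its own column and `upperCover` supply two elements above it, so exactly one is missing.
  matching : ∀ k → k < n → Matching k
  matching k k<n = record
    { τ           = τ
    ; τ-injective = τ-injective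
    ; unmatched   = unmatched
    ; matched     = λ {i} → proj₂ (missing i)
    }
    where
    _⋖_ : Fin 3 → Fin 3 → Set
    i ⋖ j = row k i <ₚ row (suc k) j

    clamp-suc : toℕ (clamp n (suc k)) ≡ suc (toℕ (clamp n k))
    clamp-suc = trans (toℕ-clamp k<n) (cong suc (sym (toℕ-clamp (<⇒≤ k<n))))

    ⋖-next : ∀ {i j} → i ⋖ j → next i ⋖ next j
    ⋖-next = cyclic _ _ _ _

    ⋖-next⁻ : ∀ {i j} → next i ⋖ next j → i ⋖ j
    ⋖-next⁻ {i} {j} i⋖j = subst₂ _⋖_ (next³ i) (next³ j) (⋖-next (⋖-next i⋖j))

    somewhere : ∃[ i ] ∃[ j ] ¬ i ⋖ j
    somewhere with incomplete (fromℕ< k<n)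
    ... | i , j , i⋖̸j = i , j , subst₂ (λ l m → ¬ [ i , l ] <ₚ [ j , m ])
      (Fin.toℕ-injective (trans (Fin.toℕ-inject₁ _) (trans (Fin.toℕ-fromℕ< k<n) (sym (toℕ-clamp (<⇒≤ k<n))))))
      (Fin.toℕ-injective (trans (cong suc (Fin.toℕ-fromℕ< k<n)) (sym (toℕ-clamp k<n)))) i⋖̸j

    missing : ∀ i → ∃[ j ] ¬ i ⋖ j
    missing x with somewhere
    ... | i , j , i⋖̸j with orbit i x
    ...   | inj₁ refl        = j , i⋖̸j
    ...   | inj₂ (inj₁ refl) = next j , i⋖̸j ∘ ⋖-next⁻
    ...   | inj₂ (inj₂ refl) = next (next j) , i⋖̸j ∘ ⋖-next⁻ ∘ ⋖-next⁻

    τ : Fin 3 → Fin 3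
    τ i = proj₁ (missing i)

    τ-avoids : ∀ {i j} → i ⋖ j → τ i ≢ j
    τ-avoids {i} i⋖j τi≡j = proj₂ (missing i) (subst (i ⋖_) (sym τi≡j) i⋖j)

    ⋖-column : ∀ i → i ⋖ i
    ⋖-column i = increasing i _ _ (≤-reflexive (sym clamp-suc))

    unmatched : ∀ {i j} → j ≢ τ i → i ⋖ j
    unmatched {i} {j} j≢τi with b , b≢i , i⋖b ← upperCover i clamp-suc
      with distinct-cover _ _ _ (τ-avoids (⋖-column i) , τ-avoids i⋖b , ≢-sym b≢i) j
    ... | inj₁ j≡τi        = contradiction j≡τi j≢τi
    ... | inj₂ (inj₁ refl) = ⋖-column i
    ... | inj₂ (inj₂ refl) = i⋖b

    τ-next : ∀ i → τ (next i) ≡ next (τ i)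
    τ-next i with next (τ i) Fin.≟ τ (next i)
    ... | yes eq = sym eq
    ... | no  ≢  = contradiction (⋖-next⁻ (unmatched ≢)) (proj₂ (missing i))

    -- τ commutes with `next`, so a collision would give `next` a fixed point.
    τ-injective : Injective _≡_ _≡_ τ
    τ-injective {i} {x} τi≡τx with orbit i x
    ... | inj₁ refl        = refl
    ... | inj₂ (inj₁ refl) = contradiction (sym (trans τi≡τx (τ-next i))) (next-≢ (τ i))
    ... | inj₂ (inj₂ refl) = contradiction
      (trans (cong next (trans τi≡τx (trans (τ-next _) (cong next (τ-next i))))) (next³ (τ i)))
      (next-≢ (τ i))

  -- From row n on the identity is a default value that makes `θ` total.
  chosen : ∀ k → Σ (Fin 3 → Fin 3) λ τ →
           Injective _≡_ _≡_ τ × (k < n → Σ (Matching k) λ M → Matching.τ M ≡ τ)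
  chosen k with k <? n
  ... | yes k<n = Matching.τ M , Matching.τ-injective M , λ _ → M , refl
    where M = matching k k<n
  ... | no  k≮n = (λ i → i) , (λ eq → eq) , λ k<n → contradiction k<n k≮n

  -- Relabelling row k by θ k turns all matchings into the identity.
  θ : ℕ → Fin 3 → Fin 3
  θ zero    i = i
  θ (suc k) i = proj₁ (chosen k) (θ k i)

  θ-injective : ∀ k → Injective _≡_ _≡_ (θ k)
  θ-injective zero    eq = eq
  θ-injective (suc k) eq = θ-injective k (proj₁ (proj₂ (chosen k)) eq)

  θ⁻¹ : ℕ → Fin 3 → Fin 3
  θ⁻¹ k i = proj₁ (injective⇒surjective (θ k) (θ-injective k) i)

  θ-θ⁻¹ : ∀ k i → θ k (θ⁻¹ k i) ≡ i
  θ-θ⁻¹ k i = proj₂ (injective⇒surjective (θ k) (θ-injective k) i)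

  θ⁻¹-θ : ∀ k i → θ⁻¹ k (θ k i) ≡ i
  θ⁻¹-θ k i = θ-injective k (θ-θ⁻¹ k (θ k i))

  point : Point → Carrier
  point (a , k) = row k (θ k a)

  coord : Carrier → Point
  coord p = let i , k = Inverse.from label p in θ⁻¹ (toℕ k) i , toℕ k

  point-coord : ∀ p → point (coord p) ≡ p
  point-coord p with i , k , refl ← labelled p
    rewrite Inverse.strictlyInverseʳ label (i , k) = cong₂ [_,_] (θ-θ⁻¹ (toℕ k) i) (clamp-toℕ k)

  coord-point : ∀ x → level x ≤ n → coord (point x) ≡ x
  coord-point (a , k) k≤n rewrite Inverse.strictlyInverseʳ label (θ k a , clamp n k)
                                | toℕ-clamp k≤n = cong (_, k) (θ⁻¹-θ k a)

  point-step : ∀ {a b k} → k < n → a ≢ b → point (a , k) <ₚ point (b , suc k)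
  point-step {a} {b} {k} k<n a≢b with M , τ≡ ← proj₂ (proj₂ (chosen k)) k<n =
    Matching.unmatched M λ eq → a≢b (sym (θ-injective k (proj₁ (proj₂ (chosen k))
      (trans eq (cong (λ τ → τ (θ k a)) τ≡)))))

  point-step⁻ : ∀ {a b k} → k < n → point (a , k) <ₚ point (b , suc k) → a ≢ b
  point-step⁻ {a} {b} {k} k<n p<q refl with M , τ≡ ← proj₂ (proj₂ (chosen k)) k<n =
    Matching.matched M (subst (λ τ → row k (θ k a) <ₚ row (suc k) (τ (θ k a))) (sym τ≡) p<q)

  -- Two levels are crossed through a column different from both ends; every further level is a
  -- single step with a change of column.
  point-jump : ∀ d {a b k} → d + (2 + k) ≤ n → point (a , k) ≤ₚ point (b , d + (2 + k))
  point-jump zero    {a} {b} {k} 2+k≤n with third a b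
  ... | c , c≢a , c≢b = ≤ₚ-trans (proj₁ (point-step {k = k} (<⇒≤ 2+k≤n) (≢-sym c≢a)))
                                 (proj₁ (point-step {k = suc k} 2+k≤n c≢b))
  point-jump (suc d) {a} {b} {k} l≤n with third b b
  ... | c , c≢b , _ = ≤ₚ-trans (point-jump d (<⇒≤ l≤n)) (proj₁ (point-step {k = d + (2 + k)} l≤n c≢b))

  point-mono : ∀ {x y} → x ⊑ y → level y ≤ n → point x ≤ₚ point y
  point-mono stay _ = ≤ₚ-refl
  point-mono {_ , k} (step a≢b) k<n = proj₁ (point-step {k = k} k<n a≢b)
  point-mono {x} {b , l} (jump k<l) l≤n = subst (λ l → point x ≤ₚ point (b , l)) (m∸n+n≡m k<l)
    (point-jump _ (subst (_≤ n) (sym (m∸n+n≡m k<l)) l≤n))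

  bounded : ∀ p → level (coord p) ≤ n
  bounded p = Fin.toℕ≤pred[n] (proj₂ (Inverse.from label p))

  point-reflect : ∀ {x y} → level x ≤ n → level y ≤ n → point x <ₚ point y → x ⊑ y
  point-reflect {a , k} {b , l} k≤n l≤n p<q with suc k ≟ l
  ... | yes refl = step (point-step⁻ l≤n p<q)
  ... | no 1+k≢l = jump (≤∧≢⇒< (subst₂ _<_ (toℕ-clamp k≤n) (toℕ-clamp l≤n) (<ₚ⇒level< p<q)) 1+k≢l)

  coord-mono : ∀ {p q} → p ≤ₚ q → coord p ⊑ coord q
  coord-mono {p} {q} p≤q with p ≟ₚ q
  ... | yes refl = stay
  ... | no  p≢q  = point-reflect (bounded p) (bounded q)
    (subst₂ _<ₚ_ (sym (point-coord p)) (sym (point-coord q)) (p≤q , p≢q))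

  coordinates : Coordinates P n
  coordinates = record
    { point       = point
    ; coord       = coord
    ; bounded     = bounded
    ; point-coord = point-coord
    ; coord-point = coord-point
    ; point-mono  = point-mono
    ; coord-mono  = coord-mono
    }

-- Two-element antichains and the conclusion.

module _ {P : FinPoset} (A : IsTwoAntichain P) where
  open Order P
  open Inverse (proj₁ A)

  antichain-rank : ∀ {r} → IsRankedOfRank P r → r ≡ 0
  antichain-rank ranked = sym (suc-injective (ranked (to 0F ∷ []) ([-] , maximal)))
    where
    maximal : ∀ d → IsChain P d → to 0F ∷ [] ⊆ d → d ⊆ to 0F ∷ []
    maximal d d-chain c⊆d p∈d with Chains.chain-comparable P d-chain p∈d (c⊆d (here refl))
    ... | inj₁ refl       = here refl
    ... | inj₂ (inj₁ p<q) = contradiction p<q (proj₂ A _ _)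
    ... | inj₂ (inj₂ q<p) = contradiction q<p (proj₂ A _ _)

  -- Any tower has two distinct elements, so its embedding already covers both elements of `P`.
  antichain-veryNice : IsVeryNice P
  antichain-veryNice Q retract proper (k , S , sections , iso)
    with σ , ¬onto ← retract⇒splitting P S Q retract proper iso
    with u , v , unbounded ← section-unboundedAbove (sections zero) = ¬onto onto
    where
    open Splitting σ

    s t : Tower P S
    s = zero , u
    t = zero , v

    s≢t : from (embed s) ≢ from (embed t)
    s≢t eq = unbounded u refl₀ (subst (λ w → FinPoset._≤_ (S zero) w u) u≡v refl₀)
      where
      refl₀ = FinPoset.≤-refl (S zero) {u}

      u≡v : u ≡ v
      u≡v = tower-injective {S = S} (trans (sym (project-embed s)) (trans (cong project
        (trans (sym (strictlyInverseˡ _)) (trans (cong to eq) (strictlyInverseˡ _)))) (project-embed t)))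

    onto : Onto
    onto p with fin2-cover s≢t (from p)
    ... | inj₁ p≡s = s , trans (sym (strictlyInverseˡ _)) (trans (cong to (sym p≡s)) (strictlyInverseˡ p))
    ... | inj₂ p≡t = t , trans (sym (strictlyInverseˡ _)) (trans (cong to (sym p≡t)) (strictlyInverseˡ p))

theorem5p12 : (P : FinPoset) (r : ℕ) → IsRankedOfRank P r → IsSection P → IsNice P → IsVeryNice P ⇔ (¬ (r > 0 × 3 ∣ r))
-- An antichain has rank 0, and both sides hold.
theorem5p12 P r ranked (inj₁ A) nice = mk⇔
  (λ _ (r>0 , _) → >⇒≢ r>0 (antichain-rank {P} A ranked))
  (λ _ → antichain-veryNice {P} A)
theorem5p12 P r ranked (inj₂ (n , n≥1 , _ , L)) nice with refl ← NiceRankedSection.rank≡n ranked nice L = mk⇔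
  (λ { veryNice (_ , divides m refl) → multiple⇒¬veryNice {m = m} C veryNice })
  (λ ¬3∣r Q retract proper (_ , S , sections , iso) →
    let σ , ¬onto = retract⇒splitting P S Q retract proper iso
    in ¬3∣r (n≥1 , SplitCrown.3∣rank C S sections σ ¬onto))
  where
  C : Coordinates P r
  C = NiceRankedSection.coordinates ranked nice L
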